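{- For every integer $n\ge1$, $$\sum_{\substack{\mathbf w\in \mathrm{PF}_n\\ \mathrm{tie}(\mathbf w)=0}}t^{\mathrm{des}(\mathbf w)}=\frac1{n+1}\sum_{\mathbf w\in \mathrm{Smir}_{n,n+1}}t^{\mathrm{des}(\mathbf w)}.$$
   Context: A parking function of length $n$ is a word $\mathbf w=(w_1,\dots,w_n)\in[n]^n$, $[n]=\{1,\dots,n\}$, whose nondecreasing rearrangement $b_1\le\dots\le b_n$ satisfies $b_i\le i$ for all $i$; $\mathrm{PF}_n$ is the set of these. For a word $\mathbf w$ of length $n$, $\mathrm{des}(\mathbf w)$ is the number of $i\in[n-1]$ with $w_i>w_{i+1}$ and $\mathrm{tie}(\mathbf w)$ is the number of $i\in[n-1]$ with $w_i=w_{i+1}$. A Smirnov word is a word with no two equal adjacent letters; $\mathrm{Smir}_{r,m}$ is the set of Smirnov words of length $r$ on the alphabet $[m]$. -}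

module Defs where

open import Data.Nat.Base using (ℕ; zero; suc; _≤_)
import Data.Nat.Properties as ℕ
open import Data.Fin.Base using (Fin; toℕ)
import Data.Fin.Properties as Fin
open import Data.List.Base as List
  using (List; []; _∷_; length; lookup; map; foldr; filter; zip; drop; allFin; cartesianProductWith)
open import Data.List.Membership.Propositional using (_∈_)
open import Data.List.Membership.Propositional.Properties
  using (∈-allFin; ∈-cartesianProductWith⁺)
import Data.List.Sort as Sort
open import Data.List.Relation.Unary.Any using (here)
open import Data.List.Relation.Unary.All using ([])
open import Data.List.Relation.Unary.AllPairs using ([]; _∷_)
open import Data.List.Relation.Unary.Unique.Propositional using (Unique)
import Data.List.Relation.Unary.Unique.Propositional.Properties as Unique
open import Data.Product.Base using (_×_; _,_)
open import Data.Rational.Base as ℚ using (ℚ; 0ℚ; 1ℚ)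
open import Data.Vec.Base as Vec using (Vec; []; _∷_; toList)
open import Data.Vec.Properties using (∷-injective)
open import Data.Vec.Relation.Unary.Linked using (Linked; linked?)
open import Relation.Binary.PropositionalEquality using (_≡_; _≢_; refl)
open import Relation.Nullary.Decidable using (Dec; ¬?)

-- Words of length r on the alphabet [m].  The element i of Fin m stands for
-- the letter i + 1; `value` recovers it.
Word : ℕ → ℕ → Set
Word r m = Vec (Fin m) r

value : ∀ {m} → Fin m → ℕ
value i = suc (toℕ i)

words : ∀ r m → List (Word r m)
words zero    m = [] ∷ []
words (suc r) m = cartesianProductWith _∷_ (allFin m) (words r m)

-- `words r m` lists every word exactly once, so that sums over (filtered)
-- `words r m` are sums over sets of words.
words-complete : ∀ {r m} (w : Word r m) → w ∈ words r m
words-complete []      = here refl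
words-complete (x ∷ w) = ∈-cartesianProductWith⁺ _∷_ (∈-allFin x) (words-complete w)

words-unique : ∀ r m → Unique (words r m)
words-unique zero    m = [] ∷ []
words-unique (suc r) m =
  Unique.cartesianProductWith⁺ _∷_ ∷-injective (Unique.allFin⁺ m) (words-unique r m)

rearrangement : ∀ {r m} → Word r m → List (Fin m)
rearrangement {m = m} w = Sort.sort (Fin.≤-decTotalOrder m) (toList w)

-- Positions of the rearrangement are also counted from zero, hence `value i`
-- on the right for the one-based position.
IsParking : ∀ {n} → Word n n → Set
IsParking w = ∀ (i : Fin (length b)) → value (lookup b i) ≤ value i
  where b = rearrangement w

isParking? : ∀ {n} (w : Word n n) → Dec (IsParking w)
isParking? w = Fin.all? λ i → value (lookup (rearrangement w) i) ℕ.≤? value i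

PF : ∀ n → List (Word n n)
PF n = filter isParking? (words n n)

-- The pairs (w i , w (i + 1)); `zip` stops at the end of the shorter list.
adjacent : ∀ {r m} → Word r m → List (Fin m × Fin m)
adjacent w = zip (toList w) (drop 1 (toList w))

des : ∀ {r m} → Word r m → ℕ
des w = length (filter (λ (x , y) → y Fin.<? x) (adjacent w))

tie : ∀ {r m} → Word r m → ℕ
tie w = length (filter (λ (x , y) → x Fin.≟ y) (adjacent w))

IsSmirnov : ∀ {r m} → Word r m → Set
IsSmirnov = Linked _≢_

isSmirnov? : ∀ {r m} (w : Word r m) → Dec (IsSmirnov w)
isSmirnov? = linked? λ x y → ¬? (x Fin.≟ y)

Smir : ∀ r m → List (Word r m)
Smir r m = filter isSmirnov? (words r m)

-- ℚ[t], as coefficient lists starting with the constant term.  Trailing zeros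
-- are allowed, so polynomials are compared by _≈_ and not by _≡_.
Poly : Set
Poly = List ℚ

coeff : Poly → ℕ → ℚ
coeff []      k       = 0ℚ
coeff (a ∷ p) zero    = a
coeff (a ∷ p) (suc k) = coeff p k

infix 4 _≈_
_≈_ : Poly → Poly → Set
p ≈ q = ∀ k → coeff p k ≡ coeff q k

infixl 6 _⊕_
_⊕_ : Poly → Poly → Poly
[]      ⊕ q       = q
(a ∷ p) ⊕ []      = a ∷ p
(a ∷ p) ⊕ (b ∷ q) = (a ℚ.+ b) ∷ (p ⊕ q)

infixr 7 _·_
_·_ : ℚ → Poly → Poly
c · p = map (c ℚ.*_) p

infix 8 t^_
t^_ : ℕ → Poly
t^ zero  = 1ℚ ∷ []
t^ suc k = 0ℚ ∷ t^ k

∑ : ∀ {A : Set} → List A → (A → Poly) → Poly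
∑ xs f = foldr (λ x p → f x ⊕ p) [] xs

infix 5 ∑
syntax ∑ xs (λ x → p) = ∑[ x ∈ xs ] p

{-# OPTIONS --safe #-}
module Submission where

-- Let N = n + 1.  Two cyclic groups act on words of length n on [N]: shifting
-- all letters modulo N, and rotating positions.  By the cycle lemma (Pollak),
-- every word has exactly one shift that is a parking function; rotation
-- preserves parking.  Shifting turns an extremal letter from a peak into a
-- valley, so in a Smirnov word it can change the number of descents only at
-- the two ends.
--
-- If the ends are equal, the changes cancel, descents are shift-invariant, and
-- the sum over all words is N times that over parking functions.  If they
-- differ, the number c of cyclic descents is invariant under both actions, and
-- des is c − 1 or c according to whether the word wraps, i.e. its last letter
-- exceeds its first.  Averaging over rotations, a proportion c / n of these
-- words wrap, among parking functions as among all words; this reduces to the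
-- shift-invariant case.

open import Defs
open import Data.Bool.Base using (true; false; if_then_else_)
open import Data.Empty using (⊥; ⊥-elim)
open import Data.Fin.Base as Fin using (Fin; zero; suc; toℕ; fromℕ; inject₁)
import Data.Fin.Properties as Fin
open import Data.Fin.Relation.Unary.Top using (view; ‵fromℕ; ‵inject₁)
open import Data.List.Base
  using (List; []; _∷_; [_]; _++_; _∷ʳ_; length; lookup; map; filter; zip; drop;
         upTo; applyUpTo; initLast; _∷ʳ′_)
open import Data.List.Membership.Propositional using (_∈_)
open import Data.List.Membership.Propositional.Properties
open import Data.List.Membership.Propositional.Properties.WithK using (unique∧set⇒bag)
open import Data.List.Properties
open import Data.List.Relation.Binary.BagAndSetEquality using (∼bag⇒↭)
open import Data.List.Relation.Binary.Permutation.Propositional using (_↭_; ↭-refl; ↭-sym)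
import Data.List.Relation.Binary.Permutation.Propositional.Properties as ↭
open import Data.List.Relation.Unary.All as All using (All; []; _∷_)
import Data.List.Relation.Unary.All.Properties as All
open import Data.List.Relation.Unary.AllPairs using ([]; _∷_)
open import Data.List.Relation.Unary.Any using (here; there)
open import Data.List.Relation.Unary.Linked as Linked using (Linked; []; [-]; _∷_)
open import Data.List.Relation.Unary.Linked.Properties using (Linked⇒All)
open import Data.List.Relation.Unary.Unique.Propositional using (Unique)
import Data.List.Relation.Unary.Unique.Propositional.Properties as Unique
import Data.List.Sort as Sort
open import Data.Nat.Base hiding (_/_)
open import Data.Nat.GeneralisedArithmetic using (fold)
open import Data.Nat.ListAction using (sum)
open import Data.Nat.ListAction.Properties using (sum-↭)
open import Data.Nat.Properties
open import Data.Nat.Tactic.RingSolver using (solve-∀)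
open import Data.Product.Base using (∃; _×_; _,_; proj₁; proj₂)
open import Data.Rational.Base as ℚ using (ℚ; _/_; toℚᵘ)
import Data.Rational.Properties as ℚ
open import Data.Rational.Unnormalised.Base as ℚᵘ using (mkℚᵘ; *≡*)
import Data.Rational.Unnormalised.Properties as ℚᵘ
open import Data.Sum.Base using (inj₁; inj₂)
open import Data.Vec.Base as Vec using (Vec; []; _∷_; toList)
import Data.Vec.Properties as Vec
import Data.Vec.Relation.Unary.Linked as Vec
open import Function.Base using (_∘_)
open import Function.Bundles using (mk⇔)
open import Relation.Binary.Definitions using (tri<; tri≈; tri>)
open import Relation.Binary.PropositionalEquality hiding ([_])
open import Relation.Nullary using (¬_; Dec; does; yes; no; ¬?; contradiction)
open import Relation.Nullary.Decidable using (_×-dec_; dec-true; dec-false; does-⇔)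
open import Relation.Unary using (Pred; Decidable)

private variable
  A B : Set
  m n : ℕ

-- Finite sums and averaging

-- Depends on `does` alone, so equivalent propositions have equal indicators however they are
-- decided.
𝟙 : {P : Set} → Dec P → ℕ
𝟙 P? = if does P? then 1 else 0

𝟙-cong : {P Q : Set} (P? : Dec P) (Q? : Dec Q) → (P → Q) → (Q → P) → 𝟙 P? ≡ 𝟙 Q?
𝟙-cong P? Q? to from = cong (if_then 1 else 0) (does-⇔ (mk⇔ to from) P? Q?)

𝟙-true : {P : Set} (P? : Dec P) → P → 𝟙 P? ≡ 1
𝟙-true P? p = cong (if_then 1 else 0) (dec-true P? p)

𝟙-false : {P : Set} (P? : Dec P) → ¬ P → 𝟙 P? ≡ 0
𝟙-false P? ¬p = cong (if_then 1 else 0) (dec-false P? ¬p)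

𝟙-*-cong : {P : Set} (P? : Dec P) {a b : ℕ} → (P → a ≡ b) → 𝟙 P? * a ≡ 𝟙 P? * b
𝟙-*-cong (yes p) a≡b = cong (1 *_) (a≡b p)
𝟙-*-cong (no _)  a≡b = refl

𝟙-× : {P Q : Set} (P? : Dec P) (Q? : Dec Q) → 𝟙 (P? ×-dec Q?) ≡ 𝟙 P? * 𝟙 Q?
𝟙-× P? Q? with does P?
... | true  = sym (+-identityʳ _)
... | false = refl

length-filter-∷ : {P : Pred A _} (P? : Decidable P) (x : A) (xs : List A) →
                  length (filter P? (x ∷ xs)) ≡ 𝟙 (P? x) + length (filter P? xs)
length-filter-∷ P? x xs with does (P? x)
... | true  = refl
... | false = refl

-- Without repetitions an element has at most one membership proof, so having the same elements
-- already makes the lists equal as bags.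
unique-↭ : {xs ys : List A} → Unique xs → Unique ys →
           (∀ {x} → x ∈ xs → x ∈ ys) → (∀ {x} → x ∈ ys → x ∈ xs) → xs ↭ ys
unique-↭ xs! ys! to from = ∼bag⇒↭ (unique∧set⇒bag xs! ys! (mk⇔ to from))

sumOver : List A → (A → ℕ) → ℕ
sumOver xs f = sum (map f xs)

sumOver-cong : (xs : List A) {f g : A → ℕ} → (∀ {x} → x ∈ xs → f x ≡ g x) →
               sumOver xs f ≡ sumOver xs g
sumOver-cong []       f≗g = refl
sumOver-cong (x ∷ xs) f≗g = cong₂ _+_ (f≗g (here refl)) (sumOver-cong xs (f≗g ∘ there))

sumOver-+ : (xs : List A) (f g : A → ℕ) →
            sumOver xs (λ x → f x + g x) ≡ sumOver xs f + sumOver xs g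
sumOver-+ []       f g = refl
sumOver-+ (x ∷ xs) f g rewrite sumOver-+ xs f g =
  interchange (f x) (g x) (sumOver xs f) (sumOver xs g)
  where
  interchange : ∀ a b c d → (a + b) + (c + d) ≡ (a + c) + (b + d)
  interchange = solve-∀

sumOver-*0 : (xs : List A) (f : A → ℕ) → sumOver xs (λ x → f x * 0) ≡ 0
sumOver-*0 []       f = refl
sumOver-*0 (x ∷ xs) f rewrite *-zeroʳ (f x) = sumOver-*0 xs f

sumOver-map : (h : A → B) (xs : List A) (f : B → ℕ) →
              sumOver (map h xs) f ≡ sumOver xs (f ∘ h)
sumOver-map h xs f = cong sum (sym (map-∘ xs))

sumOver-↭ : {xs ys : List A} (f : A → ℕ) → xs ↭ ys → sumOver xs f ≡ sumOver ys f
sumOver-↭ f xs↭ys = sum-↭ (↭.map⁺ f xs↭ys)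

sumOver-filter : {P : Pred A _} (P? : Decidable P) (f : A → ℕ) (xs : List A) →
                 sumOver (filter P? xs) f ≡ sumOver xs (λ x → 𝟙 (P? x) * f x)
sumOver-filter P? f []       = refl
sumOver-filter P? f (x ∷ xs) with does (P? x)
... | true  = cong₂ _+_ (sym (*-identityˡ (f x))) (sumOver-filter P? f xs)
... | false = sumOver-filter P? f xs

sumOver-1 : (xs : List A) → sumOver xs (λ _ → 1) ≡ length xs
sumOver-1 []       = refl
sumOver-1 (x ∷ xs) = cong suc (sumOver-1 xs)

sumOver-unique : {P : Pred ℕ _} (P? : Decidable P) (n c : ℕ) → c < n → P c →
                 (∀ {i} → i < n → P i → i ≡ c) → sumOver (upTo n) (𝟙 ∘ P?) ≡ 1
sumOver-unique {P} P? n c c<n Pc unique = begin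
  sumOver (upTo n) (𝟙 ∘ P?)              ≡⟨ sumOver-cong (upTo n) (λ _ → sym (*-identityʳ _)) ⟩
  sumOver (upTo n) (λ i → 𝟙 (P? i) * 1)  ≡⟨ sumOver-filter P? _ (upTo n) ⟨
  sumOver (filter P? (upTo n)) (λ _ → 1) ≡⟨ sumOver-↭ _ filter↭[c] ⟩
  1                                      ∎
  where
  open ≡-Reasoning
  to : ∀ {i} → i ∈ filter P? (upTo n) → i ∈ [ c ]
  to i∈ = let i∈upTo , Pi = ∈-filter⁻ P? {xs = upTo n} i∈ in here (unique (∈-upTo⁻ i∈upTo) Pi)
  from : ∀ {i} → i ∈ [ c ] → i ∈ filter P? (upTo n)
  from (here refl) = ∈-filter⁺ P? (∈-upTo⁺ c<n) Pc
  filter↭[c] : filter P? (upTo n) ↭ [ c ]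
  filter↭[c] = unique-↭ (Unique.filter⁺ P? (Unique.upTo⁺ n)) ([] ∷ []) to from

module _ {xs : List A} {π : A → A} (π-↭ : map π xs ↭ xs) where

  sumOver-fold : (f : A → ℕ) (i : ℕ) → sumOver xs (λ x → f (fold x π i)) ≡ sumOver xs f
  sumOver-fold f zero    = refl
  sumOver-fold f (suc i) = begin
    sumOver xs (λ x → f (π (fold x π i))) ≡⟨ sumOver-fold (f ∘ π) i ⟩
    sumOver xs (f ∘ π)                    ≡⟨ sumOver-map π xs f ⟨
    sumOver (map π xs) f                  ≡⟨ sumOver-↭ f π-↭ ⟩
    sumOver xs f                          ∎
    where open ≡-Reasoning

  -- For an invariant weight `g`, each iterate of `π` merely reorders the sum of `g x * f x`, so
  -- every `i` contributes the same amount. Both group actions enter the proof through this lemma.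
  averaging : (g f : A → ℕ) → (∀ x → g (π x) ≡ g x) → (is : List ℕ) →
              sumOver xs (λ x → g x * sumOver is (λ i → f (fold x π i)))
                ≡ length is * sumOver xs (λ x → g x * f x)
  averaging g f g∘π []       = sumOver-*0 xs g
  averaging g f g∘π (i ∷ is) = begin
    sumOver xs (λ x → g x * (f (fold x π i) + rest x))
      ≡⟨ sumOver-cong xs (λ {x} _ → trans (*-distribˡ-+ (g x) _ _)
                                          (cong (λ y → y * f (fold x π i) + g x * rest x) (sym (g-fold x i)))) ⟩
    sumOver xs (λ x → g (fold x π i) * f (fold x π i) + g x * rest x)
      ≡⟨ sumOver-+ xs _ _ ⟩
    sumOver xs (λ x → g (fold x π i) * f (fold x π i)) + sumOver xs (λ x → g x * rest x)
      ≡⟨ cong₂ _+_ (sumOver-fold (λ x → g x * f x) i) (averaging g f g∘π is) ⟩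
    suc (length is) * sumOver xs (λ x → g x * f x) ∎
    where
    open ≡-Reasoning
    rest : A → ℕ
    rest x = sumOver is (λ i → f (fold x π i))
    g-fold : ∀ x i → g (fold x π i) ≡ g x
    g-fold x zero    = refl
    g-fold x (suc i) = trans (g∘π _) (g-fold x i)

-- The cycle lemma

firstMin : (f : ℕ → ℕ) (k : ℕ) →
           ∃ λ c → c ≤ k × (∀ {r} → r ≤ k → f c ≤ f r) × (∀ {r} → r < c → f c < f r)
firstMin f zero    = 0 , z≤n , (λ { z≤n → ≤-refl }) , λ ()
firstMin f (suc k) with firstMin f k
... | c , c≤k , least , first with f (suc k) <? f c
... | yes f<f = suc k , ≤-refl , least′ , λ r<1+k → <-≤-trans f<f (least (s≤s⁻¹ r<1+k))
  where
  least′ : ∀ {r} → r ≤ suc k → f (suc k) ≤ f r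
  least′ r≤1+k with m≤n⇒m<n∨m≡n r≤1+k
  ... | inj₁ r<1+k = ≤-trans (<⇒≤ f<f) (least (s≤s⁻¹ r<1+k))
  ... | inj₂ refl  = ≤-refl
... | no f≮f = c , m≤n⇒m≤1+n c≤k , least′ , first
  where
  least′ : ∀ {r} → r ≤ suc k → f c ≤ f r
  least′ r≤1+k with m≤n⇒m<n∨m≡n r≤1+k
  ... | inj₁ r<1+k = least (s≤s⁻¹ r<1+k)
  ... | inj₂ refl  = ≮⇒≥ f≮f

-- Over a period of `n + 1` steps `U` rises by `n` only, so `U r - r` falls by one per period.
module CycleLemma (n : ℕ) (U : ℕ → ℕ) (drift : ∀ c → U (suc n + c) ≡ U c + n) where

  -- Says, without subtraction, that on the window r = c, ..., c + n the value `U r - r` is nowhere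
  -- less than at `c`.
  Good : ℕ → Set
  Good c = ∀ {j} → j < suc n → U c + j ≤ U (j + c)

  -- c is the first point of 0, …, n at which U r − r is least.
  good-exists : ∃ λ c → c < suc n × Good c
  -- This function is `U r - r` raised by `n + 1`; the truncated subtraction is exact because
  -- `r ≤ n`.
  good-exists with firstMin (λ r → U r + (suc n ∸ r)) n
  ... | c , c≤n , least , first = c , s≤s c≤n , good
    where
    good : Good c
    good {j} j≤n with j + c ≤? n
    ... | yes j+c≤n = +-cancelʳ-≤ (suc n ∸ (j + c)) _ _ (begin
      U c + j + (suc n ∸ (j + c))       ≡⟨ +-assoc (U c) j _ ⟩
      U c + (j + (suc n ∸ (j + c)))     ≡⟨ cong (λ m → U c + (j + (suc n ∸ m))) (+-comm j c) ⟩
      U c + (j + (suc n ∸ (c + j)))     ≡⟨ cong (λ m → U c + (j + m)) (∸-+-assoc (suc n) c j) ⟨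
      U c + (j + (suc n ∸ c ∸ j))       ≡⟨ cong (U c +_) (m+[n∸m]≡n (m+n≤o⇒m≤o∸n j (m≤n⇒m≤1+n j+c≤n))) ⟩
      U c + (suc n ∸ c)                 ≤⟨ least j+c≤n ⟩
      U (j + c) + (suc n ∸ (j + c))     ∎)
      where open ≤-Reasoning
    -- The point `j + c` lies one period beyond some `s < c`. The period costs one unit, and the
    -- strict inequality `first` at `s` makes up for it.
    ... | no j+c≰n = wrapped (j + c ∸ suc n) (m+[n∸m]≡n (≰⇒> j+c≰n))
      where
      open ≤-Reasoning
      cancel : ∀ u v d e j → u + e < v + (d + e) → u + j < v + (d + j)
      cancel u v d e j p = subst (u + j <_) (+-assoc v d j) (+-monoˡ-< j
        (+-cancelʳ-< e u (v + d) (subst (u + e <_) (sym (+-assoc v d e)) p)))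
      wrapped : ∀ s → suc n + s ≡ j + c → U c + j ≤ U (j + c)
      wrapped s N+s≡j+c = begin
        U c + j       ≤⟨ s≤s⁻¹ (subst (U c + j <_) (trans (cong (U s +_) d+j≡N) (+-suc (U s) n))
                          (cancel (U c) (U s) (c ∸ s) (suc n ∸ c) j
                            (subst (λ m → U c + (suc n ∸ c) < U s + m) N∸s (first s<c)))) ⟩
        U s + n       ≡⟨ drift s ⟨
        U (suc n + s) ≡⟨ cong U N+s≡j+c ⟩
        U (j + c)     ∎
        where
        s<c : s < c
        s<c = +-cancelˡ-< (suc n) s c (subst (_< suc n + c) (sym N+s≡j+c) (+-monoˡ-< c j≤n))
        c∸s+s : (c ∸ s) + s ≡ c
        c∸s+s = m∸n+n≡m (<⇒≤ s<c)
        d+j≡N : (c ∸ s) + j ≡ suc n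
        d+j≡N = +-cancelʳ-≡ s _ _ (trans (rearrange (c ∸ s) j s) (trans (cong (j +_) c∸s+s) (sym N+s≡j+c)))
          where
          rearrange : ∀ d j s → d + j + s ≡ j + (d + s)
          rearrange = solve-∀
        N∸s : suc n ∸ s ≡ (c ∸ s) + (suc n ∸ c)
        N∸s = +-cancelʳ-≡ s _ _ (begin-equality
          (suc n ∸ s) + s             ≡⟨ m∸n+n≡m (≤-trans (<⇒≤ s<c) (m≤n⇒m≤1+n c≤n)) ⟩
          suc n                       ≡⟨ m∸n+n≡m (m≤n⇒m≤1+n c≤n) ⟨
          (suc n ∸ c) + c             ≡⟨ cong ((suc n ∸ c) +_) c∸s+s ⟨
          (suc n ∸ c) + ((c ∸ s) + s) ≡⟨ rearrange (suc n ∸ c) (c ∸ s) s ⟩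
          (c ∸ s) + (suc n ∸ c) + s   ∎)
          where
          rearrange : ∀ e d s → e + (d + s) ≡ d + e + s
          rearrange = solve-∀

  -- U c − c ≤ U c′ − c′ ≤ U (c + n + 1) − (c + n + 1) = U c − c − 1 is absurd.
  good-≮ : ∀ {c c′} → c < c′ → c′ < suc n → Good c → Good c′ → ⊥
  good-≮ {c} {c′} c<c′ c′≤n good good′ = <-irrefl refl (+-cancelˡ-≤ (U c) (suc n) n (begin
    U c + suc n            ≡⟨ cong (U c +_) d+e≡N ⟨
    U c + (d + e)          ≡⟨ +-assoc (U c) d e ⟨
    U c + d + e            ≤⟨ +-monoˡ-≤ e (good d<N) ⟩
    U (d + c) + e          ≡⟨ cong (λ m → U m + e) d+c≡c′ ⟩
    U c′ + e               ≤⟨ good′ e<N ⟩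
    U (e + c′)             ≡⟨ cong U e+c′≡N+c ⟩
    U (suc n + c)          ≡⟨ drift c ⟩
    U c + n                ∎))
    where
    open ≤-Reasoning
    d e : ℕ
    d = c′ ∸ c
    e = suc n ∸ d
    d+c≡c′ : d + c ≡ c′
    d+c≡c′ = m∸n+n≡m (<⇒≤ c<c′)
    d<N : d < suc n
    d<N = ≤-<-trans (m∸n≤m c′ c) c′≤n
    d+e≡N : d + e ≡ suc n
    d+e≡N = m+[n∸m]≡n (<⇒≤ d<N)
    e<N : e < suc n
    e<N = ∸-monoʳ-< {suc n} {d} {0} (m<n⇒0<n∸m c<c′) (<⇒≤ d<N)
    e+c′≡N+c : e + c′ ≡ suc n + c
    e+c′≡N+c = trans (cong (e +_) (sym d+c≡c′)) (trans (rearrange e d c) (cong (_+ c) d+e≡N))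
      where
      rearrange : ∀ e d c → e + (d + c) ≡ d + e + c
      rearrange = solve-∀

  good-unique : ∀ {c c′} → c < suc n → c′ < suc n → Good c → Good c′ → c′ ≡ c
  good-unique {c} {c′} c<N c′<N good good′ with <-cmp c c′
  ... | tri< c<c′ _ _ = ⊥-elim (good-≮ c<c′ c′<N good good′)
  ... | tri≈ _ c≡c′ _ = sym c≡c′
  ... | tri> _ _ c′<c = ⊥-elim (good-≮ c′<c c<N good′ good)

-- Descents and cyclic rotation

Smirnov : List (Fin m) → Set
Smirnov = Linked _≢_

smirnov? : (l : List (Fin m)) → Dec (Smirnov l)
smirnov? = Linked.linked? (λ x y → ¬? (x Fin.≟ y))

-- `des w` unfolds to `desc (toList w)`, so the two agree by computation.
desc : List (Fin m) → ℕ
desc l = length (filter (λ (x , y) → y Fin.<? x) (zip l (drop 1 l)))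

desc-∷ : (x y : Fin m) (l : List (Fin m)) → desc (x ∷ y ∷ l) ≡ 𝟙 (y Fin.<? x) + desc (y ∷ l)
desc-∷ x y l = length-filter-∷ (λ (x , y) → y Fin.<? x) (x , y) _

-- The first letter is an argument of its own so that a last letter always exists.
ending : Fin m → List (Fin m) → Fin m
ending x []      = x
ending x (y ∷ l) = ending y l

ending-∷ʳ : (x : Fin m) (l : List (Fin m)) (z : Fin m) → ending x (l ∷ʳ z) ≡ z
ending-∷ʳ x []      z = refl
ending-∷ʳ x (y ∷ l) z = ending-∷ʳ y l z

desc-∷ʳ : (x : Fin m) (l : List (Fin m)) (z : Fin m) →
          desc (x ∷ l ∷ʳ z) ≡ desc (x ∷ l) + 𝟙 (z Fin.<? ending x l)
desc-∷ʳ x []      z = trans (desc-∷ x z []) (+-identityʳ _)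
desc-∷ʳ x (y ∷ l) z = begin
  desc (x ∷ y ∷ l ∷ʳ z)                                        ≡⟨ desc-∷ x y (l ∷ʳ z) ⟩
  𝟙 (y Fin.<? x) + desc (y ∷ l ∷ʳ z)                           ≡⟨ cong (𝟙 (y Fin.<? x) +_) (desc-∷ʳ y l z) ⟩
  𝟙 (y Fin.<? x) + (desc (y ∷ l) + 𝟙 (z Fin.<? ending y l))    ≡⟨ +-assoc (𝟙 (y Fin.<? x)) _ _ ⟨
  𝟙 (y Fin.<? x) + desc (y ∷ l) + 𝟙 (z Fin.<? ending y l)      ≡⟨ cong (_+ 𝟙 (z Fin.<? ending y l)) (desc-∷ x y l) ⟨
  desc (x ∷ y ∷ l) + 𝟙 (z Fin.<? ending y l)                   ∎
  where open ≡-Reasoning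

Smirnov-∷ʳ⁺ : {x z : Fin m} {l : List (Fin m)} → Smirnov (x ∷ l) → ending x l ≢ z → Smirnov (x ∷ l ∷ʳ z)
Smirnov-∷ʳ⁺ [-]          x≢z = x≢z ∷ [-]
Smirnov-∷ʳ⁺ (x≢y ∷ smir) e≢z = x≢y ∷ Smirnov-∷ʳ⁺ smir e≢z

Smirnov-∷ʳ⁻ : {x z : Fin m} (l : List (Fin m)) → Smirnov (x ∷ l ∷ʳ z) → Smirnov (x ∷ l) × ending x l ≢ z
Smirnov-∷ʳ⁻ []      (x≢z ∷ [-])  = [-] , x≢z
Smirnov-∷ʳ⁻ (y ∷ l) (x≢y ∷ smir) = let smir′ , e≢z = Smirnov-∷ʳ⁻ l smir in x≢y ∷ smir′ , e≢z

Smirnov-map⁺ : {f : Fin m → Fin n} → (∀ {x y} → f x ≡ f y → x ≡ y) →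
               {l : List (Fin m)} → Smirnov l → Smirnov (map f l)
Smirnov-map⁺ inj []           = []
Smirnov-map⁺ inj [-]          = [-]
Smirnov-map⁺ inj (x≢y ∷ smir) = (x≢y ∘ inj) ∷ Smirnov-map⁺ inj smir

Smirnov-map⁻ : (f : Fin m → Fin n) (l : List (Fin m)) → Smirnov (map f l) → Smirnov l
Smirnov-map⁻ f []          []           = []
Smirnov-map⁻ f (x ∷ [])    [-]          = [-]
Smirnov-map⁻ f (x ∷ y ∷ l) (x≢y ∷ smir) = (x≢y ∘ cong f) ∷ Smirnov-map⁻ f (y ∷ l) smir

rotate : List A → List A
rotate []      = []
rotate (x ∷ l) = l ∷ʳ x

rotate-injective : {l l′ : List A} → rotate l ≡ rotate l′ → l ≡ l′
rotate-injective {l = []}    {[]}     eq = refl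
rotate-injective {l = []}    {x ∷ []} ()
rotate-injective {l = []}    {x ∷ y ∷ l′} ()
rotate-injective {l = x ∷ []} {[]} ()
rotate-injective {l = x ∷ y ∷ l} {[]} ()
rotate-injective {l = x ∷ l} {y ∷ l′} eq = let l≡l′ , x≡y = ∷ʳ-injective l l′ eq in cong₂ _∷_ x≡y l≡l′

rotate-↭ : (l : List A) → rotate l ↭ l
rotate-↭ []      = ↭-refl
rotate-↭ (x ∷ l) = ↭-sym (↭.∷↭∷ʳ x l)

-- Repeating the first letter at the end turns cyclic descents and cyclic adjacency into ordinary
-- ones.
close : List A → List A
close []      = []
close (x ∷ l) = x ∷ l ∷ʳ x

-- For a nonempty word this is the number of descents that closing it adds.
wraps : List (Fin m) → ℕ
wraps []      = 0
wraps (x ∷ l) = 𝟙 (x Fin.<? ending x l)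

-- Rotation moves the first adjacent pair of the closed word to its end and keeps the others.
desc-close-rotate : (l : List (Fin m)) → desc (close (rotate l)) ≡ desc (close l)
desc-close-rotate []          = refl
desc-close-rotate (x ∷ [])    = refl
desc-close-rotate (x ∷ y ∷ l) = begin
  desc (y ∷ (l ∷ʳ x) ∷ʳ y)                              ≡⟨ desc-∷ʳ y (l ∷ʳ x) y ⟩
  desc (y ∷ l ∷ʳ x) + 𝟙 (y Fin.<? ending y (l ∷ʳ x))    ≡⟨ cong (λ z → desc (y ∷ l ∷ʳ x) + 𝟙 (y Fin.<? z)) (ending-∷ʳ y l x) ⟩
  desc (y ∷ l ∷ʳ x) + 𝟙 (y Fin.<? x)                    ≡⟨ +-comm _ (𝟙 (y Fin.<? x)) ⟩
  𝟙 (y Fin.<? x) + desc (y ∷ l ∷ʳ x)                    ≡⟨ desc-∷ x y (l ∷ʳ x) ⟨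
  desc (x ∷ y ∷ l ∷ʳ x)                                 ∎
  where open ≡-Reasoning

Smirnov-close-rotate⁺ : (l : List (Fin m)) → Smirnov (close l) → Smirnov (close (rotate l))
Smirnov-close-rotate⁺ []          smir         = smir
Smirnov-close-rotate⁺ (x ∷ [])    smir         = smir
Smirnov-close-rotate⁺ (x ∷ y ∷ l) (x≢y ∷ smir) =
  Smirnov-∷ʳ⁺ smir (λ e≡y → x≢y (trans (sym (ending-∷ʳ y l x)) e≡y))

Smirnov-close-rotate⁻ : (l : List (Fin m)) → Smirnov (close (rotate l)) → Smirnov (close l)
Smirnov-close-rotate⁻ []          smir = smir
Smirnov-close-rotate⁻ (x ∷ [])    smir = smir
Smirnov-close-rotate⁻ (x ∷ y ∷ l) smir =
  let smir′ , e≢y = Smirnov-∷ʳ⁻ (l ∷ʳ x) smir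
  in (λ x≡y → e≢y (trans (ending-∷ʳ y l x) x≡y)) ∷ smir′

fold-suc : (f : A → A) (x : A) (i : ℕ) → fold x f (suc i) ≡ fold (f x) f i
fold-suc f x zero    = refl
fold-suc f x (suc i) = cong f (fold-suc f x i)

-- `fold` applies `π` outermost; moving the first application innermost lets an induction restart
-- from `π x`.
sumOver-fold-suc : (f : A → ℕ) (π : A → A) (x : A) (k : ℕ) →
                   sumOver (applyUpTo suc (suc k)) (λ i → f (fold x π i))
                     ≡ f (π x) + sumOver (applyUpTo suc k) (λ i → f (fold (π x) π i))
sumOver-fold-suc f π x k = cong (f (π x) +_) (begin
  sumOver (applyUpTo (2 +_) k) (λ i → f (fold x π i))
    ≡⟨ cong (λ is → sumOver is (λ i → f (fold x π i))) (map-applyUpTo suc suc k) ⟨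
  sumOver (map suc (applyUpTo suc k)) (λ i → f (fold x π i))
    ≡⟨ sumOver-map suc (applyUpTo suc k) _ ⟩
  sumOver (applyUpTo suc k) (λ i → f (fold x π (suc i)))
    ≡⟨ sumOver-cong (applyUpTo suc k) (λ {i} _ → cong f (fold-suc π x i)) ⟩
  sumOver (applyUpTo suc k) (λ i → f (fold (π x) π i)) ∎)
  where open ≡-Reasoning

-- With `z` first and `x` last, the wrap is the comparison that the adjacent pair `x`, `z`
-- contributes to `desc`.
wraps-∷ʳ : (z : Fin m) (w : List (Fin m)) (x : Fin m) (t : List (Fin m)) →
           wraps (z ∷ w ∷ʳ x) + desc (z ∷ t) ≡ desc (x ∷ z ∷ t)
wraps-∷ʳ z w x t = trans (cong (λ e → 𝟙 (z Fin.<? e) + desc (z ∷ t)) (ending-∷ʳ z w x)) (sym (desc-∷ x z t))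

-- Rotating by i + 1 wraps exactly at a descent from position i of u to the next letter.
sum-wraps-++ : (u : List (Fin m)) (y : Fin m) (v : List (Fin m)) →
               sumOver (applyUpTo suc (length u)) (λ i → wraps (fold (u ++ y ∷ v) rotate i)) ≡ desc (u ∷ʳ y)
sum-wraps-++ []      y v = refl
sum-wraps-++ {m} (x ∷ u) y v = begin
  sumOver (applyUpTo suc (suc (length u))) (λ i → wraps (fold (x ∷ u ++ y ∷ v) rotate i))
    ≡⟨ sumOver-fold-suc wraps rotate (x ∷ u ++ y ∷ v) (length u) ⟩
  wraps ((u ++ y ∷ v) ∷ʳ x) + sumOver (applyUpTo suc (length u)) (λ i → wraps (fold ((u ++ y ∷ v) ∷ʳ x) rotate i))
    ≡⟨ cong (λ l → wraps ((u ++ y ∷ v) ∷ʳ x) + sumOver (applyUpTo suc (length u)) (λ i → wraps (fold l rotate i)))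
            (++-assoc u (y ∷ v) [ x ]) ⟩
  wraps ((u ++ y ∷ v) ∷ʳ x) + sumOver (applyUpTo suc (length u)) (λ i → wraps (fold (u ++ y ∷ v ∷ʳ x) rotate i))
    -- The letter `x` that was moved joins the part after `y`, which is why the induction keeps `v`
    -- arbitrary.
    ≡⟨ cong (wraps ((u ++ y ∷ v) ∷ʳ x) +_) (sum-wraps-++ u y (v ∷ʳ x)) ⟩
  wraps ((u ++ y ∷ v) ∷ʳ x) + desc (u ∷ʳ y)
    ≡⟨ first u ⟩
  desc (x ∷ u ∷ʳ y) ∎
  where
  open ≡-Reasoning
  first : (u : List (Fin m)) → wraps ((u ++ y ∷ v) ∷ʳ x) + desc (u ∷ʳ y) ≡ desc (x ∷ u ∷ʳ y)
  first []      = wraps-∷ʳ y v x []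
  first (z ∷ u) = wraps-∷ʳ z (u ++ y ∷ v) x (u ∷ʳ y)

-- The rotations by 1, ..., `length l` bring each cyclically adjacent pair to the two ends exactly
-- once, and `wraps` tests that pair for a descent.
sum-wraps : (l : List (Fin m)) →
            sumOver (applyUpTo suc (length l)) (λ i → wraps (fold l rotate i)) ≡ desc (close l)
sum-wraps []      = refl
sum-wraps (x ∷ l) = begin
  sumOver (applyUpTo suc (suc (length l))) (λ i → wraps (fold (x ∷ l) rotate i))
    ≡⟨ sumOver-fold-suc wraps rotate (x ∷ l) (length l) ⟩
  wraps (l ∷ʳ x) + sumOver (applyUpTo suc (length l)) (λ i → wraps (fold (l ∷ʳ x) rotate i))
    -- After one rotation `x` is last and serves as the letter that follows the prefix `l`.
    ≡⟨ cong (wraps (l ∷ʳ x) +_) (sum-wraps-++ l x []) ⟩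
  wraps (l ∷ʳ x) + desc (l ∷ʳ x)
    ≡⟨ first l ⟩
  desc (x ∷ l ∷ʳ x) ∎
  where
  open ≡-Reasoning
  first : (l : List (Fin _)) → wraps (l ∷ʳ x) + desc (l ∷ʳ x) ≡ desc (x ∷ l ∷ʳ x)
  first []      = sym (desc-∷ x x [])
  first (z ∷ l) = wraps-∷ʳ z l x (l ∷ʳ x)

-- Cyclic shift of the alphabet

-- The shift goes down so that, for `j ≤ n + 1`, the letters below `j` are those that pass through
-- `zero` in the first `j` shifts.
pred-mod : Fin (suc n) → Fin (suc n)
pred-mod {n} zero = fromℕ n
pred-mod (suc i)  = inject₁ i

pred-mod-injective : {x y : Fin (suc n)} → pred-mod x ≡ pred-mod y → x ≡ y
pred-mod-injective {x = zero}  {zero}  eq = refl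
pred-mod-injective {x = zero}  {suc j} eq = contradiction eq Fin.fromℕ≢inject₁
pred-mod-injective {x = suc i} {zero}  eq = contradiction (sym eq) Fin.fromℕ≢inject₁
pred-mod-injective {x = suc i} {suc j} eq = cong suc (Fin.inject₁-injective eq)

isZero : Fin n → ℕ
isZero x = 𝟙 (toℕ x <? 1)

-- Only comparisons with `zero` change, since the least letter becomes the greatest; the `isZero`
-- terms record this without subtraction.
pred-mod-<-cong : (x y : Fin (suc n)) → x ≢ y →
  𝟙 (pred-mod y Fin.<? pred-mod x) + isZero y ≡ 𝟙 (y Fin.<? x) + isZero x
pred-mod-<-cong zero    zero    x≢y = contradiction refl x≢y
pred-mod-<-cong {n} zero (suc j) x≢y =
  cong (_+ 0) (𝟙-true (inject₁ j Fin.<? fromℕ n) (subst (toℕ (inject₁ j) <_) (sym (Fin.toℕ-fromℕ n)) (Fin.inject₁ℕ< j)))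
pred-mod-<-cong {n} (suc i) zero x≢y =
  cong (_+ 1) (𝟙-false (fromℕ n Fin.<? inject₁ i)
    (≤⇒≯ (subst (toℕ (inject₁ i) ≤_) (sym (Fin.toℕ-fromℕ n)) (<⇒≤ (Fin.inject₁ℕ< i)))))
pred-mod-<-cong (suc i) (suc j) x≢y = cong (_+ 0)
  (𝟙-cong (inject₁ j Fin.<? inject₁ i) (suc j Fin.<? suc i)
    (s≤s ∘ subst₂ _<_ (Fin.toℕ-inject₁ j) (Fin.toℕ-inject₁ i))
    (subst₂ _<_ (sym (Fin.toℕ-inject₁ j)) (sym (Fin.toℕ-inject₁ i)) ∘ s≤s⁻¹))

-- A letter 0 turns from a valley into a peak, which matters at the two ends only.
desc-pred-mod : (x : Fin (suc n)) (l : List (Fin (suc n))) → Smirnov (x ∷ l) →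
  desc (map pred-mod (x ∷ l)) + isZero (ending x l) ≡ desc (x ∷ l) + isZero x
desc-pred-mod x []      smir         = refl
desc-pred-mod x (y ∷ l) (x≢y ∷ smir) = begin
  desc (map pred-mod (x ∷ y ∷ l)) + isZero (ending y l)
    ≡⟨ cong (_+ isZero (ending y l)) (desc-∷ (pred-mod x) (pred-mod y) (map pred-mod l)) ⟩
  𝟙 (pred-mod y Fin.<? pred-mod x) + desc (map pred-mod (y ∷ l)) + isZero (ending y l)
    ≡⟨ +-assoc (𝟙 (pred-mod y Fin.<? pred-mod x)) _ _ ⟩
  𝟙 (pred-mod y Fin.<? pred-mod x) + (desc (map pred-mod (y ∷ l)) + isZero (ending y l))
    ≡⟨ cong (𝟙 (pred-mod y Fin.<? pred-mod x) +_) (desc-pred-mod y l smir) ⟩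
  𝟙 (pred-mod y Fin.<? pred-mod x) + (desc (y ∷ l) + isZero y)
    -- The `isZero y` left by the tail is what the comparison of `x` and `y` consumes, so interior
    -- zeros cancel.
    ≡⟨ swapʳ (𝟙 (pred-mod y Fin.<? pred-mod x)) (desc (y ∷ l)) (isZero y) ⟩
  𝟙 (pred-mod y Fin.<? pred-mod x) + isZero y + desc (y ∷ l)
    ≡⟨ cong (_+ desc (y ∷ l)) (pred-mod-<-cong x y x≢y) ⟩
  𝟙 (y Fin.<? x) + isZero x + desc (y ∷ l)
    ≡⟨ swapʳ′ (𝟙 (y Fin.<? x)) (isZero x) (desc (y ∷ l)) ⟩
  𝟙 (y Fin.<? x) + desc (y ∷ l) + isZero x
    ≡⟨ cong (_+ isZero x) (desc-∷ x y l) ⟨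
  desc (x ∷ y ∷ l) + isZero x ∎
  where
  open ≡-Reasoning
  swapʳ : ∀ a b c → a + (b + c) ≡ a + c + b
  swapʳ = solve-∀
  swapʳ′ : ∀ a b c → a + b + c ≡ a + c + b
  swapʳ′ = solve-∀

-- With equal ends the two corrections in `desc-pred-mod` coincide. This serves both words with
-- equal ends and closed words.
desc-pred-mod-cyclic : (x : Fin (suc n)) (l : List (Fin (suc n))) → Smirnov (x ∷ l) → ending x l ≡ x →
                       desc (map pred-mod (x ∷ l)) ≡ desc (x ∷ l)
desc-pred-mod-cyclic x l smir e≡x = +-cancelʳ-≡ (isZero x) _ _
  (trans (cong (λ e → desc (map pred-mod (x ∷ l)) + isZero e) (sym e≡x)) (desc-pred-mod x l smir))

ending-map : (f : Fin m → Fin n) (x : Fin m) (l : List (Fin m)) → ending (f x) (map f l) ≡ f (ending x l)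
ending-map f x []      = refl
ending-map f x (y ∷ l) = ending-map f y l

close-map : (f : A → B) (l : List A) → close (map f l) ≡ map f (close l)
close-map f []      = refl
close-map f (x ∷ l) = cong (f x ∷_) (sym (map-++ f l [ x ]))

-- Parking words over any alphabet

below : ℕ → List (Fin m) → ℕ
below j l = length (filter (λ x → toℕ x <? j) l)

below-∷ : (j : ℕ) (x : Fin m) (l : List (Fin m)) → below j (x ∷ l) ≡ 𝟙 (toℕ x <? j) + below j l
below-∷ j = length-filter-∷ (λ x → toℕ x <? j)

-- The counting form of parking: at least `j` letters have one-based value at most `j`. It ignores
-- order and makes sense on `n + 1` letters, where the shift acts. The bound on `j` has the form
-- that `allUpTo?` decides.
Parks : List (Fin m) → Set
Parks l = ∀ {j} → j < suc (length l) → j ≤ below j l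

parks? : (l : List (Fin m)) → Dec (Parks l)
parks? l = allUpTo? (λ j → j ≤? below j l) (suc (length l))

below-↭ : (j : ℕ) {l l′ : List (Fin m)} → l ↭ l′ → below j l ≡ below j l′
below-↭ j l↭l′ = ↭.↭-length (↭.filter-↭ (λ x → toℕ x <? j) l↭l′)

Parks-↭ : {l l′ : List (Fin m)} → l ↭ l′ → Parks l → Parks l′
Parks-↭ l↭l′ parks {j} j≤n =
  subst (j ≤_) (below-↭ j l↭l′) (parks (subst (λ k → j < suc k) (sym (↭.↭-length l↭l′)) j≤n))

below-0 : (l : List (Fin m)) → below 0 l ≡ 0
below-0 []      = refl
below-0 (x ∷ l) = below-0 l

below-all : (l : List (Fin m)) → below m l ≡ length l
below-all {m} l = cong length (filter-all (λ x → toℕ x <? m) (All.universal Fin.toℕ<n l))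

-- `zero` shifts to the top letter, which `j ≤ n` keeps out of the count, so it needs the term
-- `isZero`; every other letter drops by one.
pred-mod-below : (j : ℕ) → j ≤ n → (x : Fin (suc n)) →
                 𝟙 (toℕ x <? suc j) ≡ 𝟙 (toℕ (pred-mod x) <? j) + isZero x
pred-mod-below {n} j j≤n zero    =
  cong (_+ 1) (sym (𝟙-false (toℕ (fromℕ n) <? j) (≤⇒≯ (subst (j ≤_) (sym (Fin.toℕ-fromℕ n)) j≤n))))
pred-mod-below j j≤n (suc i) = trans
  (𝟙-cong (suc (toℕ i) <? suc j) (toℕ (inject₁ i) <? j)
    (subst (_< j) (sym (Fin.toℕ-inject₁ i)) ∘ s≤s⁻¹) (s≤s ∘ subst (_< j) (Fin.toℕ-inject₁ i)))
  (sym (+-identityʳ _))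

below-suc : (j : ℕ) → j ≤ n → (l : List (Fin (suc n))) →
            below (suc j) l ≡ below j (map pred-mod l) + below 1 l
below-suc j j≤n []      = refl
below-suc j j≤n (x ∷ l) = begin
  below (suc j) (x ∷ l)
    ≡⟨ below-∷ (suc j) x l ⟩
  𝟙 (toℕ x <? suc j) + below (suc j) l
    ≡⟨ cong₂ _+_ (pred-mod-below j j≤n x) (below-suc j j≤n l) ⟩
  (𝟙 (toℕ (pred-mod x) <? j) + isZero x) + (below j (map pred-mod l) + below 1 l)
    ≡⟨ interchange (𝟙 (toℕ (pred-mod x) <? j)) (isZero x) _ _ ⟩
  (𝟙 (toℕ (pred-mod x) <? j) + below j (map pred-mod l)) + (isZero x + below 1 l)
    ≡⟨ cong₂ _+_ (below-∷ j (pred-mod x) (map pred-mod l)) (below-∷ 1 x l) ⟨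
  below j (map pred-mod (x ∷ l)) + below 1 (x ∷ l) ∎
  where
  open ≡-Reasoning
  interchange : ∀ a b c d → (a + b) + (c + d) ≡ (a + c) + (b + d)
  interchange = solve-∀

module _ (l : List (Fin (suc n))) where

  private
    shifted : ℕ → List (Fin (suc n))
    shifted c = fold l (map pred-mod) c

    -- The letters that pass through 0 in the first c shifts; its increments over
    -- j steps are the numbers of letters below j.
    U : ℕ → ℕ
    U zero    = 0
    U (suc c) = U c + below 1 (shifted c)

    U-window : (j c : ℕ) → j ≤ suc n → U c + below j (shifted c) ≡ U (j + c)
    U-window zero    c _         = trans (cong (U c +_) (below-0 (shifted c))) (+-identityʳ _)
    U-window (suc j) c (s≤s j≤n) = begin
      U c + below (suc j) (shifted c)                       ≡⟨ cong (U c +_) (below-suc j j≤n (shifted c)) ⟩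
      U c + (below j (shifted (suc c)) + below 1 (shifted c)) ≡⟨ swapʳ (U c) _ _ ⟩
      U (suc c) + below j (shifted (suc c))                 ≡⟨ U-window j (suc c) (m≤n⇒m≤1+n j≤n) ⟩
      U (j + suc c)                                         ≡⟨ cong U (+-suc j c) ⟩
      U (suc j + c)                                         ∎
      where
      open ≡-Reasoning
      swapʳ : ∀ a b c → a + (b + c) ≡ a + c + b
      swapʳ = solve-∀

    length-shifted : ∀ c → length (shifted c) ≡ length l
    length-shifted zero    = refl
    length-shifted (suc c) = trans (length-map pred-mod (shifted c)) (length-shifted c)

  -- Pollak's argument: by `U-window`, the shift by `c` parks exactly when `c` is `Good` for `U`,
  -- and exactly one of 0, ..., n is.
  sum-parks : length l ≡ n → sumOver (upTo (suc n)) (λ c → 𝟙 (parks? (fold l (map pred-mod) c))) ≡ 1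
  sum-parks |l|≡n = let c , c<N , good = good-exists in
    sumOver-unique (parks? ∘ shifted) (suc n) c c<N (Good⇒Parks good)
      (λ c′<N parks → good-unique c<N c′<N good (Parks⇒Good parks))
    where
    -- In `n + 1` consecutive shifts each of the `n` letters passes through `zero` exactly once.
    drift : ∀ c → U (suc n + c) ≡ U c + n
    drift c = trans (sym (U-window (suc n) c ≤-refl))
      (cong (U c +_) (trans (below-all (shifted c)) (trans (length-shifted c) |l|≡n)))
    open CycleLemma n U drift
    |shifted| : ∀ c → suc (length (shifted c)) ≡ suc n
    |shifted| c = cong suc (trans (length-shifted c) |l|≡n)
    Good⇒Parks : ∀ {c} → Good c → Parks (shifted c)
    Good⇒Parks {c} good {j} j≤n = +-cancelˡ-≤ (U c) _ _
      (subst (U c + j ≤_) (sym (U-window j c (<⇒≤ j<N))) (good j<N))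
      where
      j<N : j < suc n
      j<N = subst (j <_) (|shifted| c) j≤n
    Parks⇒Good : ∀ {c} → Parks (shifted c) → Good c
    Parks⇒Good {c} parks {j} j<N = subst (U c + j ≤_) (U-window j c (<⇒≤ j<N))
      (+-monoʳ-≤ (U c) (parks (subst (j <_) (sym (|shifted| c)) j<N)))

-- Parking functions

-- Here `s` counts the entries already removed from the front. An entry at position `i < j` is at
-- most `s + i`, hence below `s + j`, so the first `j` entries all count.
positions⇒below : (b : List (Fin m)) (s : ℕ) → (∀ i → toℕ (lookup b i) ≤ s + toℕ i) →
                  ∀ {j} → j ≤ length b → j ≤ below (s + j) b
positions⇒below b       s pos {zero}  _         = z≤n
positions⇒below (x ∷ b) s pos {suc j} (s≤s j≤n) rewrite +-suc s j = begin
  suc j                                   ≤⟨ s≤s (positions⇒below b (suc s) pos′ j≤n) ⟩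
  1 + below (suc s + j) b                 ≡⟨ cong (_+ below (suc s + j) b) (𝟙-true (toℕ x <? suc s + j) x<1+s+j) ⟨
  𝟙 (toℕ x <? suc s + j) + below (suc s + j) b ≡⟨ below-∷ (suc s + j) x b ⟨
  below (suc s + j) (x ∷ b)               ∎
  where
  open ≤-Reasoning
  pos′ : ∀ i → toℕ (lookup b i) ≤ suc s + toℕ i
  pos′ i = subst (toℕ (lookup b i) ≤_) (+-suc s (toℕ i)) (pos (suc i))
  x<1+s+j : toℕ x < suc s + j
  x<1+s+j = s≤s (≤-trans (subst (toℕ x ≤_) (+-identityʳ s) (pos zero)) (m≤m+n s j))

below⇒positions : (b : List (Fin m)) (s : ℕ) → Linked Fin._≤_ b →
                  (∀ {j} → j ≤ length b → j ≤ below (s + j) b) → ∀ i → toℕ (lookup b i) ≤ s + toℕ i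
below⇒positions {m} (x ∷ b) s sorted low = pos
  where
  x≤s : toℕ x ≤ s
  x≤s with toℕ x ≤? s
  ... | yes x≤s = x≤s
  -- Taking `j = 1` demands an entry that is at most `s`; if the head exceeds `s`, sortedness makes
  -- every entry exceed it.
  ... | no  x≰s = contradiction (subst (1 ≤_) none (low {1} (s≤s z≤n))) λ ()
    where
    none : below (s + 1) (x ∷ b) ≡ 0
    none = cong length (filter-none (λ y → toℕ y <? s + 1)
      (All.map (λ {y} x≤y → ≤⇒≯ (≤-trans (≤-reflexive (+-comm s 1)) (≤-trans (≰⇒> x≰s) x≤y)))
               (Linked⇒All Fin.≤-trans Fin.≤-refl sorted)))
  pos : ∀ i → toℕ (lookup (x ∷ b) i) ≤ s + toℕ i
  pos zero    = subst (toℕ x ≤_) (sym (+-identityʳ s)) x≤s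
  pos (suc i) = subst (toℕ (lookup b i) ≤_) (sym (+-suc s (toℕ i)))
    (below⇒positions b (suc s) (Linked.tail sorted) low′ i)
    where
    -- The head lies below all these thresholds, so removing it lowers each count by exactly one.
    low′ : ∀ {j} → j ≤ length b → j ≤ below (suc s + j) b
    low′ {j} j≤n = s≤s⁻¹ (begin
      suc j                                        ≤⟨ low (s≤s j≤n) ⟩
      below (s + suc j) (x ∷ b)                    ≡⟨ cong (λ k → below k (x ∷ b)) (+-suc s j) ⟩
      below (suc s + j) (x ∷ b)                    ≡⟨ below-∷ (suc s + j) x b ⟩
      𝟙 (toℕ x <? suc s + j) + below (suc s + j) b ≡⟨ cong (_+ below (suc s + j) b) (𝟙-true (toℕ x <? suc s + j) x<1+s+j) ⟩
      1 + below (suc s + j) b                      ∎)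
      where
      open ≤-Reasoning
      x<1+s+j : toℕ x < suc s + j
      x<1+s+j = s≤s (≤-trans x≤s (m≤m+n s j))

-- `Parks` is blind to order, so it can be checked on the sorted word.
IsParking⇒Parks : (w : Word n n) → IsParking w → Parks (toList w)
IsParking⇒Parks {n} w parking = Parks-↭ (Sort.sort-↭ (Fin.≤-decTotalOrder n) (toList w))
  (λ j≤n → positions⇒below (rearrangement w) 0 (λ i → s≤s⁻¹ (parking i)) (s≤s⁻¹ j≤n))

Parks⇒IsParking : (w : Word n n) → Parks (toList w) → IsParking w
Parks⇒IsParking {n} w parks i = s≤s (below⇒positions (rearrangement w) 0
  (Sort.sort-↗ (Fin.≤-decTotalOrder n) (toList w))
  (λ j≤n → Parks-↭ (↭-sym (Sort.sort-↭ (Fin.≤-decTotalOrder n) (toList w))) parks (s≤s j≤n)) i)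

below-inject₁ : (j : ℕ) (l : List (Fin m)) → below j (map inject₁ l) ≡ below j l
below-inject₁ j []      = refl
below-inject₁ j (x ∷ l) = begin
  below j (map inject₁ (x ∷ l))                         ≡⟨ below-∷ j (inject₁ x) (map inject₁ l) ⟩
  𝟙 (toℕ (inject₁ x) <? j) + below j (map inject₁ l)    ≡⟨ cong₂ (λ y k → 𝟙 (y <? j) + k) (Fin.toℕ-inject₁ x) (below-inject₁ j l) ⟩
  𝟙 (toℕ x <? j) + below j l                            ≡⟨ below-∷ j x l ⟨
  below j (x ∷ l)                                       ∎
  where open ≡-Reasoning

Parks-inject₁⁺ : (l : List (Fin m)) → Parks l → Parks (map inject₁ l)
Parks-inject₁⁺ l parks {j} j≤n = subst (j ≤_) (sym (below-inject₁ j l))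
  (parks (subst (λ k → j < suc k) (length-map inject₁ l) j≤n))

Parks-inject₁⁻ : (l : List (Fin m)) → Parks (map inject₁ l) → Parks l
Parks-inject₁⁻ l parks {j} j≤n = subst (j ≤_) (below-inject₁ j l)
  (parks (subst (λ k → j < suc k) (sym (length-map inject₁ l)) j≤n))

desc-inject₁ : (l : List (Fin m)) → desc (map inject₁ l) ≡ desc l
desc-inject₁ []          = refl
desc-inject₁ (x ∷ [])    = refl
desc-inject₁ (x ∷ y ∷ l) = begin
  desc (map inject₁ (x ∷ y ∷ l))                                       ≡⟨ desc-∷ (inject₁ x) (inject₁ y) (map inject₁ l) ⟩
  𝟙 (inject₁ y Fin.<? inject₁ x) + desc (map inject₁ (y ∷ l))          ≡⟨ cong₂ (λ a b → 𝟙 (b <? a) + desc (map inject₁ (y ∷ l)))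
                                                                                 (Fin.toℕ-inject₁ x) (Fin.toℕ-inject₁ y) ⟩
  𝟙 (y Fin.<? x) + desc (map inject₁ (y ∷ l))                          ≡⟨ cong (𝟙 (y Fin.<? x) +_) (desc-inject₁ (y ∷ l)) ⟩
  𝟙 (y Fin.<? x) + desc (y ∷ l)                                        ≡⟨ desc-∷ x y l ⟨
  desc (x ∷ y ∷ l)                                                     ∎
  where open ≡-Reasoning

lower : (l : List (Fin (suc n))) → All (λ x → toℕ x < n) l → ∃ λ l′ → map inject₁ l′ ≡ l
lower []      []          = [] , refl
lower (x ∷ l) (x<n ∷ l<n) =
  let l′ , eq = lower l l<n
  in Fin.fromℕ< x<n ∷ l′ ,
     cong₂ _∷_ (Fin.toℕ-injective (trans (Fin.toℕ-inject₁ _) (Fin.toℕ-fromℕ< x<n))) eq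

-- At `j = length l` parking says that the filter drops no letter.
Parks⇒All< : (l : List (Fin m)) → Parks l → All (λ x → toℕ x < length l) l
Parks⇒All< l parks = subst (All _) (filter-complete P? (≤-antisym (length-filter P? l) (parks ≤-refl)))
                                   (All.all-filter P? l)
  where P? = λ x → toℕ x <? length l

-- Words as lists

-- Plain lists allow rotation and closing without casts on lengths; membership here recovers the
-- length.
wordLists : ∀ r m → List (List (Fin m))
wordLists r m = map toList (words r m)

toList-injective : {v w : Vec A n} → toList v ≡ toList w → v ≡ w
toList-injective {v = v} {w} eq = trans (sym (Vec.cast-is-id refl v)) (Vec.toList-injective refl v w eq)

wordLists-unique : ∀ r m → Unique (wordLists r m)
wordLists-unique r m = Unique.map⁺ toList-injective (words-unique r m)

∈-wordLists⁺ : {l : List (Fin m)} → length l ≡ n → l ∈ wordLists n m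
∈-wordLists⁺ {m} {l = l} refl =
  subst (_∈ wordLists (length l) m) (Vec.toList∘fromList l) (∈-map⁺ toList (words-complete (Vec.fromList l)))

∈-wordLists⁻ : {l : List (Fin m)} → l ∈ wordLists n m → length l ≡ n
∈-wordLists⁻ l∈ with w , _ , refl ← ∈-map⁻ toList l∈ = Vec.length-toList w

-- Supplies the hypothesis of `averaging` for both actions.
wordLists-↭ : {π : List (Fin m) → List (Fin m)} → (∀ l → length (π l) ≡ length l) →
              (∀ {l l′} → π l ≡ π l′ → l ≡ l′) → (∀ l → ∃ λ l′ → π l′ ≡ l) →
              map π (wordLists n m) ↭ wordLists n m
wordLists-↭ {m} {n} {π} len inj surj =
  unique-↭ (Unique.map⁺ inj (wordLists-unique n m)) (wordLists-unique n m) to from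
  where
  to : ∀ {l} → l ∈ map π (wordLists n m) → l ∈ wordLists n m
  to l∈ with l′ , l′∈ , refl ← ∈-map⁻ π l∈ = ∈-wordLists⁺ (trans (len l′) (∈-wordLists⁻ l′∈))
  from : ∀ {l} → l ∈ wordLists n m → l ∈ map π (wordLists n m)
  from {l} l∈ with l′ , refl ← surj l = ∈-map⁺ π (∈-wordLists⁺ (trans (sym (len l′)) (∈-wordLists⁻ l∈)))

length-rotate : (l : List A) → length (rotate l) ≡ length l
length-rotate l = ↭.↭-length (rotate-↭ l)

rotate-surjective : (l : List A) → ∃ λ l′ → rotate l′ ≡ l
rotate-surjective l with initLast l
... | []      = [] , refl
... | u ∷ʳ′ x = x ∷ u , refl

pred-mod-surjective : (y : Fin (suc n)) → ∃ λ x → pred-mod x ≡ y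
pred-mod-surjective y with view y
... | ‵fromℕ     = zero , refl
... | ‵inject₁ i = suc i , refl

map-surjective : {f : A → B} → (∀ y → ∃ λ x → f x ≡ y) → ∀ l → ∃ λ l′ → map f l′ ≡ l
map-surjective surj []      = [] , refl
map-surjective surj (y ∷ l) =
  let x , x≡y = surj y ; l′ , l′≡l = map-surjective surj l in x ∷ l′ , cong₂ _∷_ x≡y l′≡l

rotate-wordLists : ∀ n m → map rotate (wordLists n m) ↭ wordLists n m
rotate-wordLists n m = wordLists-↭ length-rotate rotate-injective rotate-surjective

pred-mod-wordLists : ∀ n m → map (map pred-mod) (wordLists n (suc m)) ↭ wordLists n (suc m)
pred-mod-wordLists n m =
  wordLists-↭ (length-map pred-mod) (map-injective pred-mod-injective) (map-surjective pred-mod-surjective)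

-- Counting Smirnov words by descents

park : List (Fin m) → ℕ
park l = 𝟙 (parks? l)

count? : (k : ℕ) (l : List (Fin m)) → Dec (Smirnov l × desc l ≡ k)
count? k l = smirnov? l ×-dec (desc l ≟ k)

countClosed? : (k : ℕ) (x : Fin m) (l : List (Fin m)) →
               Dec (Smirnov (x ∷ l) × ending x l ≡ x × desc (x ∷ l) ≡ k)
countClosed? k x l = smirnov? (x ∷ l) ×-dec ((ending x l Fin.≟ x) ×-dec (desc (x ∷ l) ≟ k))

count : ℕ → List (Fin m) → ℕ
count k l = 𝟙 (count? k l)

countClosed : ℕ → List (Fin m) → ℕ
countClosed k []      = 0
countClosed k (x ∷ l) = 𝟙 (countClosed? k x l)

-- Closing pairs the last letter with the first, so a nonempty word that is counted has different
-- ends. A one-letter word is never counted here and falls under `countClosed`.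
countCyclic : ℕ → List (Fin m) → ℕ
countCyclic k l = count k (close l)

countClosed-pred-mod : (k : ℕ) (l : List (Fin (suc n))) → countClosed k (map pred-mod l) ≡ countClosed k l
countClosed-pred-mod k []      = refl
countClosed-pred-mod k (x ∷ l) = 𝟙-cong (countClosed? k (pred-mod x) (map pred-mod l)) (countClosed? k x l)
  (λ (smir , e≡x , d≡k) →
    let smir′ = Smirnov-map⁻ pred-mod (x ∷ l) smir
        e≡x′  = pred-mod-injective (trans (sym (ending-map pred-mod x l)) e≡x)
    in smir′ , e≡x′ , trans (sym (desc-pred-mod-cyclic x l smir′ e≡x′)) d≡k)
  (λ (smir , e≡x , d≡k) →
    Smirnov-map⁺ pred-mod-injective smir , trans (ending-map pred-mod x l) (cong pred-mod e≡x) ,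
    trans (desc-pred-mod-cyclic x l smir e≡x) d≡k)

-- A closed word begins and ends with the same letter, which makes the number of cyclic descents
-- shift-invariant.
desc-close-pred-mod : (l : List (Fin (suc n))) → Smirnov (close l) → desc (map pred-mod (close l)) ≡ desc (close l)
desc-close-pred-mod []      smir = refl
desc-close-pred-mod (x ∷ l) smir = desc-pred-mod-cyclic x (l ∷ʳ x) smir (ending-∷ʳ x l x)

countCyclic-pred-mod : (k : ℕ) (l : List (Fin (suc n))) → countCyclic k (map pred-mod l) ≡ countCyclic k l
countCyclic-pred-mod k l = trans (cong (count k) (close-map pred-mod l)) (𝟙-cong (count? k (map pred-mod (close l))) (count? k (close l))
  (λ (smir , d≡k) →
    let smir′ = Smirnov-map⁻ pred-mod (close l) smir
    in smir′ , trans (sym (desc-close-pred-mod l smir′)) d≡k)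
  (λ (smir , d≡k) →
    Smirnov-map⁺ pred-mod-injective smir , trans (desc-close-pred-mod l smir) d≡k))

countCyclic-rotate : (k : ℕ) (l : List (Fin m)) → countCyclic k (rotate l) ≡ countCyclic k l
countCyclic-rotate k l = 𝟙-cong (count? k (close (rotate l))) (count? k (close l))
  (λ (smir , d≡k) → Smirnov-close-rotate⁻ l smir , trans (sym (desc-close-rotate l)) d≡k)
  (λ (smir , d≡k) → Smirnov-close-rotate⁺ l smir , trans (desc-close-rotate l) d≡k)

park-rotate : (l : List (Fin m)) → park (rotate l) ≡ park l
park-rotate l = 𝟙-cong (parks? (rotate l)) (parks? l) (Parks-↭ (rotate-↭ l)) (Parks-↭ (↭-sym (rotate-↭ l)))

-- Wherever the count is nonzero, the number of cyclic descents is the constant `k`.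
countCyclic-desc : (k : ℕ) (l : List (Fin m)) → countCyclic k l * desc (close l) ≡ countCyclic k l * k
countCyclic-desc k l = 𝟙-*-cong (count? k (close l)) proj₂

wraps-complement : (l : List (Fin m)) → wraps l + (1 ∸ wraps l) ≡ 1
wraps-complement []      = refl
wraps-complement (x ∷ l) with does (x Fin.<? ending x l)
... | true  = refl
... | false = refl

-- If the two ends of a Smirnov word differ, its cyclic descents are its descents and the wrap.
count-split : (k : ℕ) (x : Fin m) (l : List (Fin m)) →
  count k (x ∷ l) ≡ countClosed k (x ∷ l)
    + (countCyclic (suc k) (x ∷ l) * wraps (x ∷ l) + countCyclic k (x ∷ l) * (1 ∸ wraps (x ∷ l)))
count-split k x l with Fin.<-cmp (ending x l) x
-- Closing puts equal letters side by side, so both cyclic counts vanish.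
... | tri≈ _ e≡x _ = begin
  count k (x ∷ l)
    ≡⟨ 𝟙-cong (count? k (x ∷ l))
              (countClosed? k x l)
              (λ (smir , d≡k) → smir , e≡x , d≡k) (λ (smir , _ , d≡k) → smir , d≡k) ⟩
  countClosed k (x ∷ l)
    ≡⟨ +-identityʳ _ ⟨
  countClosed k (x ∷ l) + (0 * wraps (x ∷ l) + 0 * (1 ∸ wraps (x ∷ l)))
    ≡⟨ cong₂ (λ a b → countClosed k (x ∷ l) + (a * wraps (x ∷ l) + b * (1 ∸ wraps (x ∷ l))))
             (none (suc k)) (none k) ⟨
  _ ∎
  where
  open ≡-Reasoning
  none : ∀ k → countCyclic k (x ∷ l) ≡ 0
  none k = 𝟙-false (count? k (close (x ∷ l))) λ (smir , _) → proj₂ (Smirnov-∷ʳ⁻ l smir) e≡x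
-- Closing adds a descent, hence `suc k`.
... | tri> _ e≢x x<e = begin
  count k (x ∷ l)
    ≡⟨ 𝟙-cong (count? k (x ∷ l))
              (count? (suc k) (close (x ∷ l)))
              (λ (smir , d≡k) → Smirnov-∷ʳ⁺ smir e≢x , trans desc≡ (cong suc d≡k))
              (λ (smir , d≡k) → proj₁ (Smirnov-∷ʳ⁻ l smir) , suc-injective (trans (sym desc≡) d≡k)) ⟩
  countCyclic (suc k) (x ∷ l)
    ≡⟨ simplify (countCyclic (suc k) (x ∷ l)) (countCyclic k (x ∷ l)) ⟩
  0 + (countCyclic (suc k) (x ∷ l) * 1 + countCyclic k (x ∷ l) * (1 ∸ 1))
    ≡⟨ cong₂ (λ a b → a + (countCyclic (suc k) (x ∷ l) * b + countCyclic k (x ∷ l) * (1 ∸ b)))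
             (𝟙-false (countClosed? k x l) (λ (_ , e≡x , _) → e≢x e≡x)) wraps≡1 ⟨
  _ ∎
  where
  open ≡-Reasoning
  wraps≡1 : wraps (x ∷ l) ≡ 1
  wraps≡1 = 𝟙-true (x Fin.<? ending x l) x<e
  desc≡ : desc (x ∷ l ∷ʳ x) ≡ suc (desc (x ∷ l))
  desc≡ = trans (desc-∷ʳ x l x) (trans (cong (desc (x ∷ l) +_) wraps≡1) (+-comm _ 1))
  simplify : ∀ a b → a ≡ 0 + (a * 1 + b * 0)
  simplify = solve-∀
-- Closing adds an ascent, so `k` is unchanged.
... | tri< e<x e≢x x≮e = begin
  count k (x ∷ l)
    ≡⟨ 𝟙-cong (count? k (x ∷ l))
              (count? k (close (x ∷ l)))
              (λ (smir , d≡k) → Smirnov-∷ʳ⁺ smir e≢x , trans desc≡ d≡k)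
              (λ (smir , d≡k) → proj₁ (Smirnov-∷ʳ⁻ l smir) , trans (sym desc≡) d≡k) ⟩
  countCyclic k (x ∷ l)
    ≡⟨ simplify (countCyclic (suc k) (x ∷ l)) (countCyclic k (x ∷ l)) ⟩
  0 + (countCyclic (suc k) (x ∷ l) * 0 + countCyclic k (x ∷ l) * (1 ∸ 0))
    ≡⟨ cong₂ (λ a b → a + (countCyclic (suc k) (x ∷ l) * b + countCyclic k (x ∷ l) * (1 ∸ b)))
             (𝟙-false (countClosed? k x l) (λ (_ , e≡x , _) → e≢x e≡x)) wraps≡0 ⟨
  _ ∎
  where
  open ≡-Reasoning
  wraps≡0 : wraps (x ∷ l) ≡ 0
  wraps≡0 = 𝟙-false (x Fin.<? ending x l) x≮e
  desc≡ : desc (x ∷ l ∷ʳ x) ≡ desc (x ∷ l)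
  desc≡ = trans (desc-∷ʳ x l x) (trans (cong (desc (x ∷ l) +_) wraps≡0) (+-identityʳ _))
  simplify : ∀ a b → b ≡ 0 + (a * 0 + b * 1)
  simplify = solve-∀

module _ (n : ℕ) where

  private
    L : List (List (Fin (suc n)))
    L = wordLists n (suc n)

  -- A division-free way to say that parking words carry the fraction 1 / (n + 1) of the weight `f`.
  -- It is linear in `f`, so `count` can be treated summand by summand.
  Balanced : (List (Fin (suc n)) → ℕ) → Set
  Balanced f = suc n * sumOver L (λ l → f l * park l) ≡ sumOver L f

  balanced-cong : (f g : List (Fin (suc n)) → ℕ) → (∀ {l} → l ∈ L → f l ≡ g l) → Balanced f → Balanced g
  balanced-cong f g f≗g bal = begin
    suc n * sumOver L (λ l → g l * park l) ≡⟨ cong (suc n *_) (sumOver-cong L (λ {l} l∈ → cong (_* park l) (sym (f≗g l∈)))) ⟩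
    suc n * sumOver L (λ l → f l * park l) ≡⟨ bal ⟩
    sumOver L f                            ≡⟨ sumOver-cong L f≗g ⟩
    sumOver L g                            ∎
    where open ≡-Reasoning

  sumOver-+-park : (f g : List (Fin (suc n)) → ℕ) → suc n * sumOver L (λ l → (f l + g l) * park l)
                       ≡ suc n * sumOver L (λ l → f l * park l) + suc n * sumOver L (λ l → g l * park l)
  sumOver-+-park f g = begin
    suc n * sumOver L (λ l → (f l + g l) * park l)
      ≡⟨ cong (suc n *_) (sumOver-cong L (λ {l} _ → *-distribʳ-+ (park l) (f l) (g l))) ⟩
    suc n * sumOver L (λ l → f l * park l + g l * park l)
      ≡⟨ cong (suc n *_) (sumOver-+ L (λ l → f l * park l) (λ l → g l * park l)) ⟩
    suc n * (sumOver L (λ l → f l * park l) + sumOver L (λ l → g l * park l))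
      ≡⟨ *-distribˡ-+ (suc n) (sumOver L (λ l → f l * park l)) _ ⟩
    suc n * sumOver L (λ l → f l * park l) + suc n * sumOver L (λ l → g l * park l) ∎
    where open ≡-Reasoning

  balanced-+ : (f g : List (Fin (suc n)) → ℕ) → Balanced f → Balanced g → Balanced (λ l → f l + g l)
  balanced-+ f g bal-f bal-g =
    trans (sumOver-+-park f g) (trans (cong₂ _+_ bal-f bal-g) (sym (sumOver-+ L f g)))

  balanced-cancel : (f g : List (Fin (suc n)) → ℕ) → Balanced (λ l → f l + g l) → Balanced f → Balanced g
  balanced-cancel f g bal bal-f = +-cancelˡ-≡ (sumOver L f) _ _ (begin
    sumOver L f + suc n * sumOver L (λ l → g l * park l)
      ≡⟨ cong (_+ suc n * sumOver L (λ l → g l * park l)) bal-f ⟨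
    suc n * sumOver L (λ l → f l * park l) + suc n * sumOver L (λ l → g l * park l)
      ≡⟨ sumOver-+-park f g ⟨
    suc n * sumOver L (λ l → (f l + g l) * park l)
      ≡⟨ bal ⟩
    sumOver L (λ l → f l + g l)
      ≡⟨ sumOver-+ L f g ⟩
    sumOver L f + sumOver L g ∎)
    where open ≡-Reasoning

  -- Averaging over the shifts replaces `park` by the number of shifts that park, which is 1.
  balanced-invariant : (f : List (Fin (suc n)) → ℕ) → (∀ l → f (map pred-mod l) ≡ f l) → Balanced f
  balanced-invariant f inv = begin
    suc n * sumOver L (λ l → f l * park l)
      ≡⟨ cong (_* sumOver L (λ l → f l * park l)) (length-upTo (suc n)) ⟨
    length (upTo (suc n)) * sumOver L (λ l → f l * park l)
      ≡⟨ averaging (pred-mod-wordLists n n) f park inv (upTo (suc n)) ⟨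
    sumOver L (λ l → f l * sumOver (upTo (suc n)) (λ c → park (fold l (map pred-mod) c)))
      ≡⟨ sumOver-cong L (λ {l} l∈ → trans (cong (f l *_) (sum-parks l (∈-wordLists⁻ l∈))) (*-identityʳ (f l))) ⟩
    sumOver L f ∎
    where open ≡-Reasoning

  -- Averaging over the `n` rotations replaces `wraps` by its total over them, which `sum-wraps`
  -- evaluates.
  sumOver-wraps : (g : List (Fin (suc n)) → ℕ) → (∀ l → g (rotate l) ≡ g l) →
                  n * sumOver L (λ l → g l * wraps l) ≡ sumOver L (λ l → g l * desc (close l))
  sumOver-wraps g inv = begin
    n * sumOver L (λ l → g l * wraps l)
      ≡⟨ cong (_* sumOver L (λ l → g l * wraps l)) (length-applyUpTo suc n) ⟨
    length (applyUpTo suc n) * sumOver L (λ l → g l * wraps l)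
      ≡⟨ averaging (rotate-wordLists n (suc n)) g wraps inv (applyUpTo suc n) ⟨
    sumOver L (λ l → g l * sumOver (applyUpTo suc n) (λ i → wraps (fold l rotate i)))
      ≡⟨ sumOver-cong L (λ {l} l∈ → cong (g l *_)
           (trans (cong (λ r → sumOver (applyUpTo suc r) (λ i → wraps (fold l rotate i))) (sym (∈-wordLists⁻ l∈)))
                  (sum-wraps l))) ⟩
    sumOver L (λ l → g l * desc (close l)) ∎
    where open ≡-Reasoning

  -- `wraps` is not shift-invariant. After multiplication by `n`, both sides trade it for the number
  -- of cyclic descents, which is `k` wherever the count is nonzero, and `countCyclic k l * k` is
  -- shift-invariant.
  balanced-wraps : .{{NonZero n}} → ∀ k → Balanced (λ l → countCyclic k l * wraps l)
  balanced-wraps k = *-cancelˡ-≡ _ _ n (begin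
    n * (suc n * sumOver L (λ l → C l * wraps l * park l))
      ≡⟨ cong (λ s → n * (suc n * s)) (sumOver-cong L (λ {l} _ → swapʳ (C l) (wraps l) (park l))) ⟩
    n * (suc n * sumOver L (λ l → C l * park l * wraps l))
      ≡⟨ swapˡ n (suc n) _ ⟩
    suc n * (n * sumOver L (λ l → C l * park l * wraps l))
      -- The weight may include `park` because rotation preserves parking.
      ≡⟨ cong (suc n *_) (sumOver-wraps (λ l → C l * park l)
           (λ l → cong₂ _*_ (countCyclic-rotate k l) (park-rotate l))) ⟩
    suc n * sumOver L (λ l → C l * park l * desc (close l))
      ≡⟨ cong (suc n *_) (sumOver-cong L (λ {l} _ → trans (swapʳ (C l) (park l) (desc (close l)))
           (cong (_* park l) (countCyclic-desc k l)))) ⟩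
    suc n * sumOver L (λ l → C l * k * park l)
      ≡⟨ balanced-invariant (λ l → C l * k) (λ l → cong (_* k) (countCyclic-pred-mod k l)) ⟩
    sumOver L (λ l → C l * k)
      ≡⟨ sumOver-cong L (λ {l} _ → countCyclic-desc k l) ⟨
    sumOver L (λ l → C l * desc (close l))
      ≡⟨ sumOver-wraps C (countCyclic-rotate k) ⟨
    n * sumOver L (λ l → C l * wraps l) ∎)
    where
    open ≡-Reasoning
    C : List (Fin (suc n)) → ℕ
    C = countCyclic k
    swapʳ : ∀ a b c → a * b * c ≡ a * c * b
    swapʳ = solve-∀
    swapˡ : ∀ a b c → a * (b * c) ≡ b * (a * c)
    swapˡ = solve-∀

  -- The complement of `balanced-wraps` within `countCyclic k`, which is itself shift-invariant.
  balanced-unwrapped : .{{NonZero n}} → ∀ k → Balanced (λ l → countCyclic k l * (1 ∸ wraps l))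
  balanced-unwrapped k = balanced-cancel C·wraps C·unwrapped
    (balanced-cong C (λ l → C·wraps l + C·unwrapped l) (λ {l} _ → split l)
      (balanced-invariant C (countCyclic-pred-mod k)))
    (balanced-wraps k)
    where
    C C·wraps C·unwrapped : List (Fin (suc n)) → ℕ
    C             = countCyclic k
    C·wraps l     = C l * wraps l
    C·unwrapped l = C l * (1 ∸ wraps l)
    split : ∀ l → C l ≡ C·wraps l + C·unwrapped l
    split l = begin
      C l                             ≡⟨ *-identityʳ (C l) ⟨
      C l * 1                         ≡⟨ cong (C l *_) (wraps-complement l) ⟨
      C l * (wraps l + (1 ∸ wraps l)) ≡⟨ *-distribˡ-+ (C l) (wraps l) _ ⟩
      C·wraps l + C·unwrapped l       ∎
      where open ≡-Reasoning

  balanced-count : .{{NonZero n}} → ∀ k → Balanced (count k)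
  balanced-count k = balanced-cong (λ l → countClosed k l + (wrapped l + unwrapped l)) (count k) split
    (balanced-+ (countClosed k) (λ l → wrapped l + unwrapped l)
      (balanced-invariant (countClosed k) (countClosed-pred-mod k))
      (balanced-+ wrapped unwrapped (balanced-wraps (suc k)) (balanced-unwrapped k)))
    where
    wrapped unwrapped : List (Fin (suc n)) → ℕ
    wrapped l   = countCyclic (suc k) l * wraps l
    unwrapped l = countCyclic k l * (1 ∸ wraps l)
    split : ∀ {l} → l ∈ L → countClosed k l + (wrapped l + unwrapped l) ≡ count k l
    -- `count-split` speaks of nonempty words; a nonzero length excludes the empty one.
    split {[]}    l∈ = contradiction (∈-wordLists⁻ l∈) (≢-nonZero⁻¹ n ∘ sym)
    split {x ∷ l} _  = sym (count-split k x l)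

-- Translation to the sums over PF and Smir

IsSmirnov⇒Smirnov : (w : Word n m) → IsSmirnov w → Smirnov (toList w)
IsSmirnov⇒Smirnov []          Vec.[]           = []
IsSmirnov⇒Smirnov (x ∷ [])    Vec.[-]          = [-]
IsSmirnov⇒Smirnov (x ∷ y ∷ w) (x≢y Vec.∷ smir) = x≢y ∷ IsSmirnov⇒Smirnov (y ∷ w) smir

Smirnov⇒IsSmirnov : (w : Word n m) → Smirnov (toList w) → IsSmirnov w
Smirnov⇒IsSmirnov []          []           = Vec.[]
Smirnov⇒IsSmirnov (x ∷ [])    [-]          = Vec.[-]
Smirnov⇒IsSmirnov (x ∷ y ∷ w) (x≢y ∷ smir) = x≢y Vec.∷ Smirnov⇒IsSmirnov (y ∷ w) smir

tie-∷ : (x y : Fin m) (w : Word n m) → tie (x ∷ y ∷ w) ≡ 𝟙 (x Fin.≟ y) + tie (y ∷ w)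
tie-∷ x y w = length-filter-∷ (λ (x , y) → x Fin.≟ y) (x , y) _

tie≡0⇒Smirnov : (w : Word n m) → tie w ≡ 0 → Smirnov (toList w)
tie≡0⇒Smirnov []          _     = []
tie≡0⇒Smirnov (x ∷ [])    _     = [-]
tie≡0⇒Smirnov (x ∷ y ∷ w) tie≡0 =
  (λ x≡y → contradiction (trans (sym (𝟙-true (x Fin.≟ y) x≡y)) (m+n≡0⇒m≡0 _ sum≡0)) λ ())
  ∷ tie≡0⇒Smirnov (y ∷ w) (m+n≡0⇒n≡0 (𝟙 (x Fin.≟ y)) sum≡0)
  where
  sum≡0 : 𝟙 (x Fin.≟ y) + tie (y ∷ w) ≡ 0
  sum≡0 = trans (sym (tie-∷ x y w)) tie≡0

Smirnov⇒tie≡0 : (w : Word n m) → Smirnov (toList w) → tie w ≡ 0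
Smirnov⇒tie≡0 []          []           = refl
Smirnov⇒tie≡0 (x ∷ [])    [-]          = refl
Smirnov⇒tie≡0 (x ∷ y ∷ w) (x≢y ∷ smir) =
  trans (tie-∷ x y w) (cong₂ _+_ (𝟙-false (x Fin.≟ y) x≢y) (Smirnov⇒tie≡0 (y ∷ w) smir))

sumOver-Smir : ∀ r m k → sumOver (Smir r m) (λ w → 𝟙 (des w ≟ k)) ≡ sumOver (wordLists r m) (count k)
sumOver-Smir r m k = begin
  sumOver (Smir r m) (λ w → 𝟙 (des w ≟ k))
    ≡⟨ sumOver-filter isSmirnov? (λ w → 𝟙 (des w ≟ k)) (words r m) ⟩
  sumOver (words r m) (λ w → 𝟙 (isSmirnov? w) * 𝟙 (des w ≟ k))
    ≡⟨ sumOver-cong (words r m) (λ {w} _ → trans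
         (cong (_* 𝟙 (des w ≟ k)) (𝟙-cong (isSmirnov? w) (smirnov? (toList w)) (IsSmirnov⇒Smirnov w) (Smirnov⇒IsSmirnov w)))
         (sym (𝟙-× (smirnov? (toList w)) (des w ≟ k)))) ⟩
  sumOver (words r m) (λ w → count k (toList w))
    ≡⟨ sumOver-map toList (words r m) (count k) ⟨
  sumOver (wordLists r m) (count k) ∎
  where open ≡-Reasoning

-- Places parking functions among the words on `n + 1` letters, on which the shift acts.
embed : Word n n → List (Fin (suc n))
embed w = map inject₁ (toList w)

-- A word on [n + 1] that parks has no letter n + 1.
PF-↭ : ∀ n → map embed (filter (λ w → tie w ≟ 0) (PF n))
             ↭ filter smirnov? (filter parks? (wordLists n (suc n)))
PF-↭ n = unique-↭
  (Unique.map⁺ (toList-injective ∘ map-injective Fin.inject₁-injective)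
    (Unique.filter⁺ tie? (Unique.filter⁺ isParking? (words-unique n n))))
  (Unique.filter⁺ smirnov? (Unique.filter⁺ parks? (wordLists-unique n (suc n))))
  to from
  where
  tie? : (w : Word n n) → Dec (tie w ≡ 0)
  tie? w = tie w ≟ 0
  to : ∀ {l} → l ∈ map embed (filter tie? (PF n)) → l ∈ filter smirnov? (filter parks? (wordLists n (suc n)))
  to l∈ with w , w∈ , refl ← ∈-map⁻ embed l∈ =
    let w∈PF , tie≡0 = ∈-filter⁻ tie? {xs = PF n} w∈
        _ , parking  = ∈-filter⁻ isParking? {xs = words n n} w∈PF
    in ∈-filter⁺ smirnov?
         (∈-filter⁺ parks? (∈-wordLists⁺ (trans (length-map inject₁ (toList w)) (Vec.length-toList w)))
           (Parks-inject₁⁺ (toList w) (IsParking⇒Parks w parking)))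
         (Smirnov-map⁺ Fin.inject₁-injective (tie≡0⇒Smirnov w tie≡0))
  from : ∀ {l} → l ∈ filter smirnov? (filter parks? (wordLists n (suc n))) → l ∈ map embed (filter tie? (PF n))
  from {l} l∈ =
    let l∈parks , smir = ∈-filter⁻ smirnov? {xs = filter parks? (wordLists n (suc n))} l∈
        l∈L , parks    = ∈-filter⁻ parks? {xs = wordLists n (suc n)} l∈parks
        l′ , eq        = lower l (subst (λ k → All (λ x → toℕ x < k) l) (∈-wordLists⁻ l∈L) (Parks⇒All< l parks))
    in preimage l′ eq (trans (sym (length-map inject₁ l′)) (trans (cong length eq) (∈-wordLists⁻ l∈L))) smir parks
    where
    -- With `l′` and its equation as arguments, matching on `refl` replaces `l` by the embedded
    -- word.
    preimage : ∀ l′ → map inject₁ l′ ≡ l → length l′ ≡ n → Smirnov l → Parks l →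
               l ∈ map embed (filter tie? (PF n))
    preimage l′ refl len smir parks
      with w , _ , refl ← ∈-map⁻ toList (∈-wordLists⁺ {l = l′} len) =
      ∈-map⁺ embed (∈-filter⁺ tie?
        (∈-filter⁺ isParking? (words-complete w) (Parks⇒IsParking w (Parks-inject₁⁻ (toList w) parks)))
        (Smirnov⇒tie≡0 w (Smirnov-map⁻ inject₁ (toList w) smir)))

sumOver-PF : ∀ n k → sumOver (filter (λ w → tie w ≟ 0) (PF n)) (λ w → 𝟙 (des w ≟ k))
                     ≡ sumOver (wordLists n (suc n)) (λ l → count k l * park l)
sumOver-PF n k = begin
  sumOver (filter (λ w → tie w ≟ 0) (PF n)) (λ w → 𝟙 (des w ≟ k))
    ≡⟨ sumOver-cong (filter (λ w → tie w ≟ 0) (PF n)) (λ {w} _ → cong (λ d → 𝟙 (d ≟ k)) (sym (desc-inject₁ (toList w)))) ⟩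
  sumOver (filter (λ w → tie w ≟ 0) (PF n)) (λ w → 𝟙 (desc (embed w) ≟ k))
    ≡⟨ sumOver-map embed (filter (λ w → tie w ≟ 0) (PF n)) (λ l → 𝟙 (desc l ≟ k)) ⟨
  sumOver (map embed (filter (λ w → tie w ≟ 0) (PF n))) (λ l → 𝟙 (desc l ≟ k))
    ≡⟨ sumOver-↭ (λ l → 𝟙 (desc l ≟ k)) (PF-↭ n) ⟩
  sumOver (filter smirnov? (filter parks? L)) (λ l → 𝟙 (desc l ≟ k))
    ≡⟨ sumOver-filter smirnov? (λ l → 𝟙 (desc l ≟ k)) (filter parks? L) ⟩
  sumOver (filter parks? L) (λ l → 𝟙 (smirnov? l) * 𝟙 (desc l ≟ k))
    ≡⟨ sumOver-filter parks? (λ l → 𝟙 (smirnov? l) * 𝟙 (desc l ≟ k)) L ⟩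
  sumOver L (λ l → park l * (𝟙 (smirnov? l) * 𝟙 (desc l ≟ k)))
    ≡⟨ sumOver-cong L (λ {l} _ → trans (*-comm (park l) _) (cong (_* park l) (sym (𝟙-× (smirnov? l) (desc l ≟ k))))) ⟩
  sumOver L (λ l → count k l * park l) ∎
  where
  open ≡-Reasoning
  L : List (List (Fin (suc n)))
  L = wordLists n (suc n)

-- Coefficients

-- Opened only here because the constructor +_ clashes with sections of _+_ on ℕ.
open import Data.Integer.Base as ℤ using (+_)
import Data.Integer.Properties as ℤ

-- `_/_` normalises its fraction and does not compute on variables, so the identity is checked on
-- unnormalised rationals.
/1-homo-+ : (a b : ℕ) → (+ a / 1) ℚ.+ (+ b / 1) ≡ + (a + b) / 1
/1-homo-+ a b = ℚ.toℚᵘ-injective (begin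
  toℚᵘ ((+ a / 1) ℚ.+ (+ b / 1))          ≈⟨ ℚ.toℚᵘ-homo-+ (+ a / 1) (+ b / 1) ⟩
  toℚᵘ (+ a / 1) ℚᵘ.+ toℚᵘ (+ b / 1)      ≈⟨ ℚᵘ.+-cong (ℚ.toℚᵘ-fromℚᵘ (mkℚᵘ (+ a) 0)) (ℚ.toℚᵘ-fromℚᵘ (mkℚᵘ (+ b) 0)) ⟩
  mkℚᵘ (+ a) 0 ℚᵘ.+ mkℚᵘ (+ b) 0          ≈⟨ *≡* (cong (ℤ._* + 1) (cong₂ ℤ._+_ (ℤ.*-identityʳ (+ a)) (ℤ.*-identityʳ (+ b)))) ⟩
  mkℚᵘ (+ (a + b)) 0                      ≈⟨ ℚ.toℚᵘ-fromℚᵘ (mkℚᵘ (+ (a + b)) 0) ⟨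
  toℚᵘ (+ (a + b) / 1)                    ∎)
  where open ℚᵘ.≃-Reasoning

1/N*N* : (n a : ℕ) → (+ 1 / suc n) ℚ.* (+ (suc n * a) / 1) ≡ + a / 1
1/N*N* n a = ℚ.toℚᵘ-injective (begin
  toℚᵘ ((+ 1 / suc n) ℚ.* (+ (suc n * a) / 1))           ≈⟨ ℚ.toℚᵘ-homo-* (+ 1 / suc n) (+ (suc n * a) / 1) ⟩
  toℚᵘ (+ 1 / suc n) ℚᵘ.* toℚᵘ (+ (suc n * a) / 1)       ≈⟨ ℚᵘ.*-cong (ℚ.toℚᵘ-fromℚᵘ (mkℚᵘ (+ 1) n)) (ℚ.toℚᵘ-fromℚᵘ (mkℚᵘ (+ (suc n * a)) 0)) ⟩
  mkℚᵘ (+ 1) n ℚᵘ.* mkℚᵘ (+ (suc n * a)) 0               ≈⟨ *≡* (trans (ℤ.*-identityʳ (+ 1 ℤ.* + (suc n * a))) (trans (ℤ.*-identityˡ (+ (suc n * a)))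
                                                               (trans (cong +_ N*a≡a*N) (ℤ.pos-* a (suc n * 1))))) ⟩
  mkℚᵘ (+ a) 0                                           ≈⟨ ℚ.toℚᵘ-fromℚᵘ (mkℚᵘ (+ a) 0) ⟨
  toℚᵘ (+ a / 1)                                         ∎)
  where
  open ℚᵘ.≃-Reasoning
  N*a≡a*N : suc n * a ≡ a * (suc n * 1)
  N*a≡a*N = trans (*-comm (suc n) a) (cong (a *_) (sym (*-identityʳ (suc n))))

coeff-⊕ : (p q : Poly) (k : ℕ) → coeff (p ⊕ q) k ≡ coeff p k ℚ.+ coeff q k
coeff-⊕ []      q       k       = sym (ℚ.+-identityˡ _)
coeff-⊕ (a ∷ p) []      k       = sym (ℚ.+-identityʳ _)
coeff-⊕ (a ∷ p) (b ∷ q) zero    = refl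
coeff-⊕ (a ∷ p) (b ∷ q) (suc k) = coeff-⊕ p q k

coeff-· : (c : ℚ) (p : Poly) (k : ℕ) → coeff (c · p) k ≡ c ℚ.* coeff p k
coeff-· c []      k       = sym (ℚ.*-zeroʳ c)
coeff-· c (a ∷ p) zero    = refl
coeff-· c (a ∷ p) (suc k) = coeff-· c p k

coeff-t^ : (d k : ℕ) → coeff (t^ d) k ≡ + 𝟙 (d ≟ k) / 1
coeff-t^ zero    zero    = refl
coeff-t^ zero    (suc k) = refl
coeff-t^ (suc d) zero    = refl
coeff-t^ (suc d) (suc k) = trans (coeff-t^ d k)
  (cong (λ i → + i / 1) (𝟙-cong (d ≟ k) (suc d ≟ suc k) (cong suc) suc-injective))

-- Reduces the polynomial identity to an identity of natural numbers for each `k`.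
coeff-∑ : (xs : List A) (d : A → ℕ) (k : ℕ) →
          coeff (∑[ x ∈ xs ] t^ d x) k ≡ + sumOver xs (λ x → 𝟙 (d x ≟ k)) / 1
coeff-∑ []       d k = refl
coeff-∑ (x ∷ xs) d k = begin
  coeff (t^ d x ⊕ ∑ xs (λ x → t^ d x)) k                          ≡⟨ coeff-⊕ (t^ d x) _ k ⟩
  coeff (t^ d x) k ℚ.+ coeff (∑ xs (λ x → t^ d x)) k              ≡⟨ cong₂ ℚ._+_ (coeff-t^ (d x) k) (coeff-∑ xs d k) ⟩
  (+ 𝟙 (d x ≟ k) / 1) ℚ.+ (+ sumOver xs (λ x → 𝟙 (d x ≟ k)) / 1)  ≡⟨ /1-homo-+ (𝟙 (d x ≟ k)) _ ⟩
  + sumOver (x ∷ xs) (λ x → 𝟙 (d x ≟ k)) / 1                      ∎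
  where open ≡-Reasoning

theorem3p4 : (n : ℕ) → 1 ≤ n →
    (∑[ w ∈ filter (λ w → tie w ≟ 0) (PF n) ] t^ des w)
    ≈ (+ 1 / suc n) · (∑[ w ∈ Smir n (suc n) ] t^ des w)
-- Splitting `n` provides the `NonZero` instance; the length is now `suc n` and the larger alphabet
-- has `suc (suc n)` letters.
theorem3p4 (suc n) _ k = begin
  coeff (∑[ w ∈ filter (λ w → tie w ≟ 0) (PF (suc n)) ] t^ des w) k
    ≡⟨ coeff-∑ (filter (λ w → tie w ≟ 0) (PF (suc n))) des k ⟩
  + sumOver (filter (λ w → tie w ≟ 0) (PF (suc n))) (λ w → 𝟙 (des w ≟ k)) / 1
    ≡⟨ cong (λ s → + s / 1) (sumOver-PF (suc n) k) ⟩
  + parking / 1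
    -- Inserting the factor and its inverse exposes the left side of `Balanced`.
    ≡⟨ 1/N*N* (suc n) parking ⟨
  (+ 1 / suc (suc n)) ℚ.* (+ (suc (suc n) * parking) / 1)
    ≡⟨ cong (λ s → (+ 1 / suc (suc n)) ℚ.* (+ s / 1))
            (trans (balanced-count (suc n) k) (sym (sumOver-Smir (suc n) (suc (suc n)) k))) ⟩
  (+ 1 / suc (suc n)) ℚ.* (+ sumOver (Smir (suc n) (suc (suc n))) (λ w → 𝟙 (des w ≟ k)) / 1)
    ≡⟨ cong ((+ 1 / suc (suc n)) ℚ.*_) (coeff-∑ (Smir (suc n) (suc (suc n))) des k) ⟨
  (+ 1 / suc (suc n)) ℚ.* coeff (∑[ w ∈ Smir (suc n) (suc (suc n)) ] t^ des w) k
    ≡⟨ coeff-· (+ 1 / suc (suc n)) (∑[ w ∈ Smir (suc n) (suc (suc n)) ] t^ des w) k ⟨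
  coeff ((+ 1 / suc (suc n)) · (∑[ w ∈ Smir (suc n) (suc (suc n)) ] t^ des w)) k ∎
  where
  open ≡-Reasoning
  parking : ℕ
  parking = sumOver (wordLists (suc n) (suc (suc n))) (λ l → count k l * park l)
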